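{- Let $f:\mathbb{Z}_+\to[0,\infty)$ be a function with $f(n)\log^2 n\to 0$ as $n\to\infty$. For every $\varepsilon\in(0,1/2)$ there exist $n_0\in\mathbb{Z}_+$ and $\delta=\delta(\varepsilon)>0$ such that the following holds. Let $G$ be a graph with $n\ge n_0$ vertices, $m\ge(1-f(n))n^2/2$ edges, and maximum density $\rho(G)=m/n$. If $$k\ge(1+\delta)\sqrt{\frac{\rho(G)}{\log\rho(G)}},$$ then with probability at least $1-\varepsilon$, $G$ is conflict $\{c_v\}$-colorable for a random local $k$-partition $\{c_v\}$ of $G$.
   Context: For a graph $G$ and vertex $v$, $E(v)$ is the set of edges incident with $v$. A local $k$-partition of $G$ is a collection $\{c_v\}$ of maps $c_v:E(v)\to\{1,\dots,k\}$; $G$ is conflict $\{c_v\}$-colorable if there is $\varphi:V(G)\to\{1,\dots,k\}$ such that no edge $e=xy$ has $\varphi(x)=c_x(e)$ and $\varphi(y)=c_y(e)$. A random local $k$-partition is obtained by choosing, for each edge $e=xy$, the pair $(c_x(e),c_y(e))$ uniformly at random from $[k]^2$, independently over edges. The maximum density is $\rho(G)=\max\{|E(G')|/|V(G')|:\emptyset\ne G'\subseteq G\}$. $\log$ is the natural logarithm. -}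

module Defs where

import Algebra.Definitions.RawSemiring
open import Data.Bool using (if_then_else_)
open import Data.Empty using (⊥-elim)
open import Data.Fin as Fin using (Fin; finToFun; funToFin; remQuot)
open import Data.Fin.Properties as Finₚ using (finToFun-funToFin; any?; all?)
open import Data.Fin.Subset using (Subset; _∈_; ∣_∣)
open import Data.Integer as ℤ using (+_; -[1+_])
import Data.Integer.Properties as ℤₚ
open import Data.List using (List; length; filter; allFin; cartesianProduct; lookup)
open import Data.Nat as ℕ using (ℕ; zero; suc; NonZero; z≤n; s≤s)
import Data.Nat.Properties as ℕₚ
open import Data.Product using (∃-syntax; _×_; _,_; proj₁; proj₂)
open import Data.Rational as ℚ using (ℚ; mkℚ; 0ℚ; 1ℚ; ½; _+_; _*_; -_; _-_; _/_; 1/_; _⊔_; _≤_; _<_; *≤*; Positive; toℚᵘ)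
open import Data.Rational.Properties
open import Data.Rational.Solver using (module +-*-Solver)
import Data.Rational.Unnormalised as ℚᵘ
import Data.Rational.Unnormalised.Properties as ℚᵘₚ
open import Data.Sum as Sum using (_⊎_; inj₁; inj₂)
open import Function using (case_of_)
open import Level using (0ℓ)
open import Relation.Binary using (Rel; Symmetric; Irreflexive; Decidable)
open import Relation.Binary.PropositionalEquality
open import Relation.Nullary using (¬_; Dec; yes; no; does)
open import Relation.Nullary.Decidable using (recompute; map′; ¬?; _×-dec_)
import Relation.Unary as U

open Algebra.Definitions.RawSemiring ℚ.+-*-rawSemiring using (_^_)
open +-*-Solver using (solve; _:=_; _:+_; _:*_; :-_; _:-_; con)

fromℕℚ : ℕ → ℚ
fromℕℚ n = + n / 1

≤-by : ∀ {a b} d → 0ℚ ≤ d → b ≡ a + d → a ≤ b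
≤-by {a} {b} d 0≤d b≡a+d = subst₂ _≤_ (+-identityʳ a) (sym b≡a+d) (+-monoʳ-≤ a 0≤d)

0≤- : ∀ {a b} → a ≤ b → 0ℚ ≤ b - a
0≤- {a} {b} a≤b = subst (_≤ b - a) (+-inverseʳ a) (+-monoˡ-≤ (- a) a≤b)

0≤* : ∀ {a b} → 0ℚ ≤ a → 0ℚ ≤ b → 0ℚ ≤ a * b
0≤* {a} {b} 0≤a 0≤b = nonNegative⁻¹ (a * b)
  ⦃ nonNeg*nonNeg⇒nonNeg a ⦃ ℚ.nonNegative 0≤a ⦄ b ⦃ ℚ.nonNegative 0≤b ⦄ ⦄

0<* : ∀ {a b} → 0ℚ < a → 0ℚ < b → 0ℚ < a * b
0<* {a} {b} 0<a 0<b = positive⁻¹ (a * b)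
  ⦃ pos*pos⇒pos a ⦃ ℚ.positive 0<a ⦄ b ⦃ ℚ.positive 0<b ⦄ ⦄

0≤+ : ∀ {a b} → 0ℚ ≤ a → 0ℚ ≤ b → 0ℚ ≤ a + b
0≤+ 0≤a 0≤b = +-mono-≤ 0≤a 0≤b

*-mono₂ : ∀ {a b c d} → 0ℚ ≤ c → 0ℚ ≤ b → a ≤ b → c ≤ d → a * c ≤ b * d
*-mono₂ {a} {b} {c} {d} 0≤c 0≤b a≤b c≤d = ≤-trans
  (*-monoʳ-≤-nonNeg c ⦃ ℚ.nonNegative 0≤c ⦄ a≤b)
  (*-monoˡ-≤-nonNeg b ⦃ ℚ.nonNegative 0≤b ⦄ c≤d)

0≤1 : 0ℚ ≤ 1ℚ
0≤1 = nonNegative⁻¹ 1ℚ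

0<1 : 0ℚ < 1ℚ
0<1 = positive⁻¹ 1ℚ

half : ∀ {ε} → 0ℚ < ε → 0ℚ < ε * ½
half 0<ε = 0<* 0<ε (positive⁻¹ ½)

half+half : ∀ ε → ε * ½ + ε * ½ ≡ ε
half+half ε = trans (sym (*-distribˡ-+ ε ½ ½)) (*-identityʳ ε)

∣∣-≤ : ∀ {p q} → p ≤ q → - p ≤ q → ℚ.∣ p ∣ ≤ q
∣∣-≤ {p} {q} p≤q -p≤q with ∣p∣≡p∨∣p∣≡-p p
... | inj₁ eq = subst (_≤ q) (sym eq) p≤q
... | inj₂ eq = subst (_≤ q) (sym eq) -p≤q

p≤∣p∣ : ∀ p → p ≤ ℚ.∣ p ∣
p≤∣p∣ p with ≤-total 0ℚ p
... | inj₁ 0≤p = ≤-reflexive (sym (0≤p⇒∣p∣≡p 0≤p))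
... | inj₂ p≤0 = ≤-trans p≤0 (0≤∣p∣ p)

∣-∣-sym : ∀ p q → ℚ.∣ p - q ∣ ≡ ℚ.∣ q - p ∣
∣-∣-sym p q = trans
  (cong ℚ.∣_∣ (solve 2 (λ p q → p :- q := :- (q :- p)) refl p q)) (∣-p∣≡∣p∣ (q - p))

split-tolerance : ∀ {B ε} → 0ℚ < B → 0ℚ < ε → ∃[ η ] 0ℚ < η × B * η ≡ ε
split-tolerance {B} {ε} 0<B 0<ε = 1/ B * ε , 0<* 0<1/B 0<ε ,
  trans (sym (*-assoc B (1/ B) ε))
    (trans (cong (_* ε) (*-inverseʳ B)) (*-identityˡ ε))
  where
  instance
    _ : Positive B
    _ = ℚ.positive 0<B
    _ : ℚ.NonZero B
    _ = pos⇒nonZero B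
  0<1/B : 0ℚ < 1/ B
  0<1/B = positive⁻¹ (1/ B) ⦃ 1/pos⇒pos B ⦄

fromℕℚ-suc : ∀ n → fromℕℚ (suc n) ≡ 1ℚ + fromℕℚ n
fromℕℚ-suc n = toℚᵘ-injective (begin
  toℚᵘ (fromℕℚ (suc n))                 ≈⟨ toℚᵘ-fromℚᵘ (ℚᵘ.mkℚᵘ (+ suc n) 0) ⟩
  ℚᵘ.mkℚᵘ (+ suc n) 0                   ≈⟨ ℚᵘ.*≡* (cong (λ k → (+ 1 ℤ.+ k) ℤ.* + 1) (sym (ℤₚ.*-identityʳ (+ n)))) ⟩
  ℚᵘ.mkℚᵘ (+ 1) 0 ℚᵘ.+ ℚᵘ.mkℚᵘ (+ n) 0  ≈⟨ ℚᵘₚ.+-congʳ (ℚᵘ.mkℚᵘ (+ 1) 0) (toℚᵘ-fromℚᵘ (ℚᵘ.mkℚᵘ (+ n) 0)) ⟨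
  toℚᵘ 1ℚ ℚᵘ.+ toℚᵘ (fromℕℚ n)          ≈⟨ toℚᵘ-homo-+ 1ℚ (fromℕℚ n) ⟨
  toℚᵘ (1ℚ + fromℕℚ n)                  ∎)
  where open ℚᵘₚ.≃-Reasoning

0≤fromℕℚ : ∀ n → 0ℚ ≤ fromℕℚ n
0≤fromℕℚ n = nonNegative⁻¹ (fromℕℚ n) ⦃ normalize-nonNeg n 1 ⦄

fromℕℚ-mono : ∀ {m n} → m ℕ.≤ n → fromℕℚ m ≤ fromℕℚ n
fromℕℚ-mono {n = n} z≤n = 0≤fromℕℚ n
fromℕℚ-mono {suc m} {suc n} (s≤s m≤n) =
  subst₂ _≤_ (sym (fromℕℚ-suc m)) (sym (fromℕℚ-suc n)) (+-monoʳ-≤ 1ℚ (fromℕℚ-mono m≤n))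

fromℕℚ-* : ∀ m n → fromℕℚ (m ℕ.* n) ≡ fromℕℚ m * fromℕℚ n
fromℕℚ-* m n = toℚᵘ-injective (begin
  toℚᵘ (fromℕℚ (m ℕ.* n))               ≈⟨ toℚᵘ-fromℚᵘ (ℚᵘ.mkℚᵘ (+ (m ℕ.* n)) 0) ⟩
  ℚᵘ.mkℚᵘ (+ (m ℕ.* n)) 0               ≈⟨ ℚᵘ.*≡* (cong (ℤ._* + 1) (ℤₚ.pos-* m n)) ⟩
  ℚᵘ.mkℚᵘ (+ m) 0 ℚᵘ.* ℚᵘ.mkℚᵘ (+ n) 0  ≈⟨ ℚᵘₚ.*-cong (toℚᵘ-fromℚᵘ (ℚᵘ.mkℚᵘ (+ m) 0)) (toℚᵘ-fromℚᵘ (ℚᵘ.mkℚᵘ (+ n) 0)) ⟨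
  toℚᵘ (fromℕℚ m) ℚᵘ.* toℚᵘ (fromℕℚ n)  ≈⟨ toℚᵘ-homo-* (fromℕℚ m) (fromℕℚ n) ⟨
  toℚᵘ (fromℕℚ m * fromℕℚ n)            ∎)
  where open ℚᵘₚ.≃-Reasoning

unit : ℕ → ℚ
unit n = + 1 / suc n

0<unit : ∀ n → 0ℚ < unit n
0<unit n = positive⁻¹ (unit n) ⦃ normalize-pos 1 (suc n) ⦄

suc*unit : ∀ n → fromℕℚ (suc n) * unit n ≡ 1ℚ
suc*unit n = toℚᵘ-injective (begin
  toℚᵘ (fromℕℚ (suc n) * unit n)            ≈⟨ toℚᵘ-homo-* (fromℕℚ (suc n)) (unit n) ⟩
  toℚᵘ (fromℕℚ (suc n)) ℚᵘ.* toℚᵘ (unit n)  ≈⟨ ℚᵘₚ.*-cong (toℚᵘ-fromℚᵘ (ℚᵘ.mkℚᵘ (+ suc n) 0)) (toℚᵘ-fromℚᵘ (ℚᵘ.mkℚᵘ (+ 1) n)) ⟩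
  ℚᵘ.mkℚᵘ (+ suc n) 0 ℚᵘ.* ℚᵘ.mkℚᵘ (+ 1) n  ≈⟨ ℚᵘ.*≡* (cong (λ k → + suc k) (trans (trans (ℕₚ.*-identityʳ _) (ℕₚ.*-identityʳ n)) (sym (trans (ℕₚ.+-identityʳ _) (ℕₚ.+-identityʳ n))))) ⟩
  ℚᵘ.1ℚᵘ                                    ∎)
  where open ℚᵘₚ.≃-Reasoning

unit≤1 : ∀ n → unit n ≤ 1ℚ
unit≤1 n = subst₂ _≤_ (*-identityˡ (unit n)) (suc*unit n)
  (*-monoʳ-≤-nonNeg (unit n) ⦃ ℚ.nonNegative (<⇒≤ (0<unit n)) ⦄ (fromℕℚ-mono (s≤s (z≤n {n}))))

q≤∣numerator∣ : ∀ q → q ≤ fromℕℚ ℤ.∣ ℚ.ℚ.numerator q ∣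
q≤∣numerator∣ q@(mkℚ -[1+ n ] d c) = ≤-trans (<⇒≤ (negative⁻¹ q)) (0≤fromℕℚ (suc n))
q≤∣numerator∣ (mkℚ (+ n) d c) = toℚᵘ-cancel-≤ (ℚᵘₚ.≤-trans
  (ℚᵘ.*≤* (ℤₚ.*-monoˡ-≤-nonNeg (+ n) (ℤ.+≤+ (s≤s z≤n))))
  (ℚᵘₚ.≤-reflexive (ℚᵘₚ.≃-sym (toℚᵘ-fromℚᵘ (ℚᵘ.mkℚᵘ (+ n) 0)))))

*-rotate : ∀ a b c → a * (b * c) ≡ (a * c) * b
*-rotate = solve 3 (λ a b c → a :* (b :* c) := (a :* c) :* b) refl

*-swap : ∀ a b c → a * (b * c) ≡ (b * a) * c
*-swap = solve 3 (λ a b c → a :* (b :* c) := (b :* a) :* c) refl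

archimedean : ∀ a {c} → 0ℚ < c → ∃[ N ] ∀ n → N ℕ.≤ n → a ≤ fromℕℚ n * c
archimedean a {c} 0<c with split-tolerance 0<c 0<1
... | η , 0<η , c*η≡1 = ℤ.∣ ℚ.ℚ.numerator (a * η) ∣ , λ n N≤n → begin
  a                 ≡⟨ *-identityʳ a ⟨
  a * 1ℚ            ≡⟨ cong (a *_) c*η≡1 ⟨
  a * (c * η)       ≡⟨ *-rotate a c η ⟩
  (a * η) * c       ≤⟨ *-monoʳ-≤-nonNeg c ⦃ ℚ.nonNegative (<⇒≤ 0<c) ⦄ (≤-trans (q≤∣numerator∣ (a * η)) (fromℕℚ-mono N≤n)) ⟩
  fromℕℚ n * c      ∎
  where open ≤-Reasoning

reciprocal≤ : ∀ {u m η} → 0ℚ < u → m * u ≡ 1ℚ → 1ℚ ≤ m * η → u ≤ η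
reciprocal≤ {u} {m} {η} 0<u m*u≡1 1≤m*η = begin
  u            ≡⟨ *-identityʳ u ⟨
  u * 1ℚ       ≤⟨ *-monoˡ-≤-nonNeg u ⦃ ℚ.nonNegative (<⇒≤ 0<u) ⦄ 1≤m*η ⟩
  u * (m * η)  ≡⟨ *-swap u m η ⟩
  (m * u) * η  ≡⟨ cong (_* η) m*u≡1 ⟩
  1ℚ * η       ≡⟨ *-identityˡ η ⟩
  η            ∎
  where open ≤-Reasoning

unit→0 : ∀ {η} → 0ℚ < η → ∃[ N ] ∀ n → N ℕ.≤ n → unit n ≤ η
unit→0 {η} 0<η = let N , bound = archimedean 1ℚ 0<η in N , λ n N≤n →
  reciprocal≤ {unit n} {fromℕℚ (suc n)} (0<unit n) (suc*unit n) (bound (suc n) (ℕₚ.m≤n⇒m≤1+n N≤n))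

IsCauchy : (ℕ → ℚ) → Set
IsCauchy x = ∀ ε → 0ℚ < ε → ∃[ N ] ∀ m n → N ℕ.≤ m → N ℕ.≤ n → ℚ.∣ x m - x n ∣ ≤ ε

-- Cauchy reals; x and y denote the same real number when x ≤ℝ y and y ≤ℝ x.
record ℝ : Set where
  constructor mkℝ
  field
    seq    : ℕ → ℚ
    cauchy : IsCauchy seq

open ℝ

infix  4 _≤ℝ_ _<ℝ_
infixl 6 _+ℝ_ _-ℝ_
infixl 7 _*ℝ_
infix  8 -ℝ_ √_

_≤ℝ_ : ℝ → ℝ → Set
x ≤ℝ y = ∀ ε → 0ℚ < ε → ∃[ N ] ∀ n → N ℕ.≤ n → seq x n ≤ seq y n + ε

_<ℝ_ : ℝ → ℝ → Set
x <ℝ y = ∃[ ε ] 0ℚ < ε × ∃[ N ] ∀ n → N ℕ.≤ n → seq x n + ε ≤ seq y n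

fromℚ : ℚ → ℝ
fromℚ q = mkℝ (λ _ → q) λ ε 0<ε → 0 , λ _ _ _ _ →
  subst (_≤ ε) (sym (cong ℚ.∣_∣ (+-inverseʳ q))) (<⇒≤ 0<ε)

fromℕ : ℕ → ℝ
fromℕ n = fromℚ (fromℕℚ n)

0ℝ 1ℝ : ℝ
0ℝ = fromℚ 0ℚ
1ℝ = fromℚ 1ℚ

_+ℝ_ : ℝ → ℝ → ℝ
x +ℝ y = mkℝ (λ n → seq x n + seq y n) λ ε 0<ε →
  let M , x-close = cauchy x (ε * ½) (half 0<ε)
      N , y-close = cauchy y (ε * ½) (half 0<ε)
  in M ℕ.+ N , λ m n M+N≤m M+N≤n → begin
    ℚ.∣ (seq x m + seq y m) - (seq x n + seq y n) ∣
      ≡⟨ cong ℚ.∣_∣ (solve 4 (λ a b c d → (a :+ b) :- (c :+ d) := (a :- c) :+ (b :- d)) refl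
           (seq x m) (seq y m) (seq x n) (seq y n)) ⟩
    ℚ.∣ (seq x m - seq x n) + (seq y m - seq y n) ∣
      ≤⟨ ∣p+q∣≤∣p∣+∣q∣ (seq x m - seq x n) (seq y m - seq y n) ⟩
    ℚ.∣ seq x m - seq x n ∣ + ℚ.∣ seq y m - seq y n ∣
      ≤⟨ +-mono-≤ (x-close m n (ℕₚ.m+n≤o⇒m≤o M M+N≤m) (ℕₚ.m+n≤o⇒m≤o M M+N≤n))
                  (y-close m n (ℕₚ.m+n≤o⇒n≤o M M+N≤m) (ℕₚ.m+n≤o⇒n≤o M M+N≤n)) ⟩
    ε * ½ + ε * ½
      ≡⟨ half+half ε ⟩
    ε ∎
  where open ≤-Reasoning

-ℝ_ : ℝ → ℝ
-ℝ x = mkℝ (λ n → - seq x n) λ ε 0<ε →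
  let N , close = cauchy x ε 0<ε
  in N , λ m n N≤m N≤n → subst (_≤ ε)
    (trans (∣-∣-sym (seq x m) (seq x n))
      (cong ℚ.∣_∣ (solve 2 (λ a b → b :- a := (:- a) :- (:- b)) refl (seq x m) (seq x n))))
    (close m n N≤m N≤n)

_-ℝ_ : ℝ → ℝ → ℝ
x -ℝ y = x +ℝ (-ℝ y)

bounded : ∀ x → ∃[ B ] 0ℚ < B × ∃[ N ] ∀ n → N ℕ.≤ n → ℚ.∣ seq x n ∣ ≤ B
bounded x = let N , close = cauchy x 1ℚ 0<1 in
  1ℚ + ℚ.∣ seq x N ∣ , +-mono-<-≤ 0<1 (0≤∣p∣ (seq x N)) , N , λ n N≤n → begin
  ℚ.∣ seq x n ∣
    ≡⟨ cong ℚ.∣_∣ (solve 2 (λ a b → a := (a :- b) :+ b) refl (seq x n) (seq x N)) ⟩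
  ℚ.∣ (seq x n - seq x N) + seq x N ∣
    ≤⟨ ∣p+q∣≤∣p∣+∣q∣ (seq x n - seq x N) (seq x N) ⟩
  ℚ.∣ seq x n - seq x N ∣ + ℚ.∣ seq x N ∣
    ≤⟨ +-monoˡ-≤ ℚ.∣ seq x N ∣ (close n N N≤n ℕₚ.≤-refl) ⟩
  1ℚ + ℚ.∣ seq x N ∣ ∎
  where open ≤-Reasoning

_*ℝ_ : ℝ → ℝ → ℝ
x *ℝ y = mkℝ (λ n → seq x n * seq y n) λ ε 0<ε →
  let A , 0<A , K , ∣x∣≤A = bounded x
      B , 0<B , L , ∣y∣≤B = bounded y
      η , 0<η , Aη = split-tolerance 0<A (half 0<ε)
      θ , 0<θ , Bθ = split-tolerance 0<B (half 0<ε)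
      M , x-close = cauchy x θ 0<θ
      N , y-close = cauchy y η 0<η
  in (K ℕ.+ L) ℕ.+ (M ℕ.+ N) , λ m n ≤m ≤n →
    let K≤m = ℕₚ.m+n≤o⇒m≤o K (ℕₚ.m+n≤o⇒m≤o (K ℕ.+ L) ≤m)
        L≤n = ℕₚ.m+n≤o⇒n≤o K (ℕₚ.m+n≤o⇒m≤o (K ℕ.+ L) ≤n)
        M≤m = ℕₚ.m+n≤o⇒m≤o M (ℕₚ.m+n≤o⇒n≤o (K ℕ.+ L) ≤m)
        M≤n = ℕₚ.m+n≤o⇒m≤o M (ℕₚ.m+n≤o⇒n≤o (K ℕ.+ L) ≤n)
        N≤m = ℕₚ.m+n≤o⇒n≤o M (ℕₚ.m+n≤o⇒n≤o (K ℕ.+ L) ≤m)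
        N≤n = ℕₚ.m+n≤o⇒n≤o M (ℕₚ.m+n≤o⇒n≤o (K ℕ.+ L) ≤n)
        a = seq x m ; b = seq y m ; c = seq x n ; d = seq y n
    in begin
    ℚ.∣ a * b - c * d ∣
      ≡⟨ cong ℚ.∣_∣ (solve 4 (λ a b c d → a :* b :- c :* d := a :* (b :- d) :+ d :* (a :- c)) refl a b c d) ⟩
    ℚ.∣ a * (b - d) + d * (a - c) ∣
      ≤⟨ ∣p+q∣≤∣p∣+∣q∣ (a * (b - d)) (d * (a - c)) ⟩
    ℚ.∣ a * (b - d) ∣ + ℚ.∣ d * (a - c) ∣
      ≡⟨ cong₂ _+_ (∣p*q∣≡∣p∣*∣q∣ a (b - d)) (∣p*q∣≡∣p∣*∣q∣ d (a - c)) ⟩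
    ℚ.∣ a ∣ * ℚ.∣ b - d ∣ + ℚ.∣ d ∣ * ℚ.∣ a - c ∣
      ≤⟨ +-mono-≤
           (*-mono₂ (0≤∣p∣ (b - d)) (<⇒≤ 0<A) (∣x∣≤A m K≤m) (y-close m n N≤m N≤n))
           (*-mono₂ (0≤∣p∣ (a - c)) (<⇒≤ 0<B) (∣y∣≤B n L≤n) (x-close m n M≤m M≤n)) ⟩
    A * η + B * θ
      ≡⟨ cong₂ _+_ Aη Bθ ⟩
    ε * ½ + ε * ½
      ≡⟨ half+half ε ⟩
    ε ∎
  where open ≤-Reasoning

∣_∣ℝ : ℝ → ℝ
∣ x ∣ℝ = mkℝ (λ n → ℚ.∣ seq x n ∣) λ ε 0<ε →
  let N , close = cauchy x ε 0<ε
  in N , λ m n N≤m N≤n → ∣∣-≤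
    (≤-trans (∣a∣-∣b∣≤∣a-b∣ (seq x m) (seq x n)) (close m n N≤m N≤n))
    (subst (_≤ ε) (solve 2 (λ a b → b :- a := :- (a :- b)) refl ℚ.∣ seq x m ∣ ℚ.∣ seq x n ∣)
      (≤-trans (∣a∣-∣b∣≤∣a-b∣ (seq x n) (seq x m)) (close n m N≤n N≤m)))
  where
  open ≤-Reasoning
  ∣a∣-∣b∣≤∣a-b∣ : ∀ a b → ℚ.∣ a ∣ - ℚ.∣ b ∣ ≤ ℚ.∣ a - b ∣
  ∣a∣-∣b∣≤∣a-b∣ a b = begin
    ℚ.∣ a ∣ - ℚ.∣ b ∣
      ≡⟨ cong (λ t → ℚ.∣ t ∣ - ℚ.∣ b ∣) (solve 2 (λ a b → a := (a :- b) :+ b) refl a b) ⟩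
    ℚ.∣ (a - b) + b ∣ - ℚ.∣ b ∣
      ≤⟨ +-monoˡ-≤ (- ℚ.∣ b ∣) (∣p+q∣≤∣p∣+∣q∣ (a - b) b) ⟩
    ℚ.∣ a - b ∣ + ℚ.∣ b ∣ - ℚ.∣ b ∣
      ≡⟨ solve 2 (λ s t → s :+ t :- t := s) refl ℚ.∣ a - b ∣ ℚ.∣ b ∣ ⟩
    ℚ.∣ a - b ∣ ∎

-- The witness c of 0 < x bounds x from below eventually, so truncating the
-- sequence at c does not change the real number that is inverted.
inverse : (x : ℝ) → 0ℝ <ℝ x → ℝ
inverse x (c , 0<c , K , c≤x) = mkℝ reciprocal λ ε 0<ε →
  let η , 0<η , CCη≡ε = split-tolerance (0<* 0<C 0<C) 0<ε
      N , close = cauchy x η 0<η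
  in K ℕ.+ N , λ m n K+N≤m K+N≤n →
    let R = reciprocal m ; S = reciprocal n
        xmR≡1 = x*reciprocal m (ℕₚ.m+n≤o⇒m≤o K K+N≤m)
        xnS≡1 = x*reciprocal n (ℕₚ.m+n≤o⇒m≤o K K+N≤n)
    in begin
    ℚ.∣ R - S ∣
      ≡⟨ cong ℚ.∣_∣ (begin-equality
           R - S                                      ≡⟨ cong₂ _-_ (*-identityʳ R) (*-identityʳ S) ⟨
           R * 1ℚ - S * 1ℚ                            ≡⟨ cong₂ (λ s t → R * s - S * t) xnS≡1 xmR≡1 ⟨
           R * (seq x n * S) - S * (seq x m * R)      ≡⟨ solve 4 (λ r s a b → r :* (b :* s) :- s :* (a :* r) := (r :* s) :* (b :- a)) refl R S (seq x m) (seq x n) ⟩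
           (R * S) * (seq x n - seq x m)              ∎) ⟩
    ℚ.∣ (R * S) * (seq x n - seq x m) ∣
      ≡⟨ ∣p*q∣≡∣p∣*∣q∣ (R * S) (seq x n - seq x m) ⟩
    ℚ.∣ R * S ∣ * ℚ.∣ seq x n - seq x m ∣
      ≡⟨ cong (_* ℚ.∣ seq x n - seq x m ∣) (0≤p⇒∣p∣≡p (0≤* (0≤reciprocal m) (0≤reciprocal n))) ⟩
    (R * S) * ℚ.∣ seq x n - seq x m ∣
      ≤⟨ *-mono₂ (0≤∣p∣ (seq x n - seq x m)) (<⇒≤ (0<* 0<C 0<C))
           (*-mono₂ (0≤reciprocal n) (<⇒≤ 0<C) (reciprocal≤C m) (reciprocal≤C n))
           (close n m (ℕₚ.m+n≤o⇒n≤o K K+N≤n) (ℕₚ.m+n≤o⇒n≤o K K+N≤m)) ⟩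
    (C * C) * η
      ≡⟨ CCη≡ε ⟩
    ε ∎
  where
  open ≤-Reasoning

  truncated : ℕ → ℚ
  truncated n = seq x n ⊔ c

  truncated-pos : ∀ n → Positive (truncated n)
  truncated-pos n = ℚ.positive (<-≤-trans 0<c (p≤q⊔p (seq x n) c))

  reciprocal : ℕ → ℚ
  reciprocal n = (1/ truncated n) ⦃ pos⇒nonZero (truncated n) ⦃ truncated-pos n ⦄ ⦄

  0≤reciprocal : ∀ n → 0ℚ ≤ reciprocal n
  0≤reciprocal n = <⇒≤ (positive⁻¹ (reciprocal n) ⦃ 1/pos⇒pos (truncated n) ⦃ truncated-pos n ⦄ ⦄)

  truncated*reciprocal : ∀ n → truncated n * reciprocal n ≡ 1ℚ
  truncated*reciprocal n = *-inverseʳ (truncated n) ⦃ pos⇒nonZero (truncated n) ⦃ truncated-pos n ⦄ ⦄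

  x*reciprocal : ∀ n → K ℕ.≤ n → seq x n * reciprocal n ≡ 1ℚ
  x*reciprocal n K≤n = trans
    (cong (_* reciprocal n) (sym (p≥q⇒p⊔q≡p (subst (_≤ seq x n) (+-identityˡ c) (c≤x n K≤n)))))
    (truncated*reciprocal n)

  C : ℚ
  C = proj₁ (split-tolerance 0<c 0<1)
  0<C : 0ℚ < C
  0<C = proj₁ (proj₂ (split-tolerance 0<c 0<1))
  cC≡1 : c * C ≡ 1ℚ
  cC≡1 = proj₂ (proj₂ (split-tolerance 0<c 0<1))

  reciprocal≤C : ∀ n → reciprocal n ≤ C
  reciprocal≤C n = begin
    reciprocal n                      ≡⟨ *-identityʳ (reciprocal n) ⟨
    reciprocal n * 1ℚ                 ≡⟨ cong (reciprocal n *_) cC≡1 ⟨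
    reciprocal n * (c * C)            ≤⟨ *-monoˡ-≤-nonNeg (reciprocal n) ⦃ ℚ.nonNegative (0≤reciprocal n) ⦄
                                           (*-monoʳ-≤-nonNeg C ⦃ ℚ.nonNegative (<⇒≤ 0<C) ⦄ (p≤q⊔p (seq x n) c)) ⟩
    reciprocal n * (truncated n * C)  ≡⟨ *-swap (reciprocal n) (truncated n) C ⟩
    (truncated n * reciprocal n) * C  ≡⟨ cong (_* C) (truncated*reciprocal n) ⟩
    1ℚ * C                            ≡⟨ *-identityˡ C ⟩
    C                                 ∎

divide : (x y : ℝ) → 0ℝ <ℝ y → ℝ
divide x y 0<y = x *ℝ inverse y 0<y

-- The greatest i ≤ b with (g i)² ≤ q, or 0 if there is none.
greatest : (g : ℕ → ℚ) → ℚ → ℕ → ℕ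
greatest g q zero    = zero
greatest g q (suc b) = if does (g (suc b) * g (suc b) ≤? q) then suc b else greatest g q b

if-elim : ∀ {P : Set} (Q : ℕ → Set) (P? : Dec P) {i j} →
  (P → Q i) → (¬ P → Q j) → Q (if does P? then i else j)
if-elim Q (yes p) f g = f p
if-elim Q (no ¬p) f g = g ¬p

greatest-below : ∀ (g : ℕ → ℚ) q b → greatest g q b ≡ 0 ⊎ g (greatest g q b) * g (greatest g q b) ≤ q
greatest-below g q zero    = inj₁ refl
greatest-below g q (suc b) = if-elim (λ i → i ≡ 0 ⊎ g i * g i ≤ q)
  (g (suc b) * g (suc b) ≤? q) inj₂ (λ _ → greatest-below g q b)

greatest-above : ∀ (g : ℕ → ℚ) q b → q < g (suc b) * g (suc b) →
                 q < g (suc (greatest g q b)) * g (suc (greatest g q b))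
greatest-above g q zero    above = above
greatest-above g q (suc b) above = if-elim (λ i → q < g (suc i) * g (suc i))
  (g (suc b) * g (suc b) ≤? q) (λ _ → above) (λ notBelow → greatest-above g q b (≰⇒> notBelow))

multiple : ℕ → ℕ → ℚ
multiple n i = fromℕℚ i * unit n

sqrtIndex : ℕ → ℚ → ℕ
sqrtIndex n q = greatest (multiple n) q (ℤ.∣ ℚ.ℚ.numerator q ∣ ℕ.* suc n)

-- The greatest multiple s of 1/(n+1) with s² ≤ q, or 0 if q is negative.
-- (No search beyond |numerator q| is needed, since q ≤ |numerator q|.)
sqrtApprox : ℕ → ℚ → ℚ
sqrtApprox n q = multiple n (sqrtIndex n q)

0≤sqrtApprox : ∀ n q → 0ℚ ≤ sqrtApprox n q
0≤sqrtApprox n q = 0≤* (0≤fromℕℚ (sqrtIndex n q)) (<⇒≤ (0<unit n))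

sqrtApprox-below : ∀ n q → sqrtApprox n q ≡ 0ℚ ⊎ sqrtApprox n q * sqrtApprox n q ≤ q
sqrtApprox-below n q = Sum.map₁ (λ eq → trans (cong (multiple n) eq) (*-zeroˡ (unit n)))
  (greatest-below (multiple n) q (ℤ.∣ ℚ.ℚ.numerator q ∣ ℕ.* suc n))

sqrtApprox-above : ∀ n q → q < (sqrtApprox n q + unit n) * (sqrtApprox n q + unit n)
sqrtApprox-above n q = subst (λ t → q < t * t) (suc-multiple (sqrtIndex n q))
  (greatest-above (multiple n) q (a ℕ.* suc n)
    (subst (λ t → q < t * t) (sym last-multiple)
      (square-above (fromℕℚ a) (unit n) (q≤∣numerator∣ q) (0<unit n) (0≤fromℕℚ a) (a≤a² a))))
  where
  a : ℕ
  a = ℤ.∣ ℚ.ℚ.numerator q ∣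

  distrib : ∀ s u → (1ℚ + s) * u ≡ s * u + u
  distrib = solve 2 (λ s u → (con 1ℚ :+ s) :* u := s :* u :+ u) refl

  suc-multiple : ∀ i → multiple n (suc i) ≡ multiple n i + unit n
  suc-multiple i = trans (cong (_* unit n) (fromℕℚ-suc i)) (distrib (fromℕℚ i) (unit n))

  last-multiple : multiple n (suc (a ℕ.* suc n)) ≡ fromℕℚ a + unit n
  last-multiple = trans (suc-multiple (a ℕ.* suc n)) (cong (_+ unit n)
    (trans (cong (_* unit n) (fromℕℚ-* a (suc n)))
      (trans (*-assoc (fromℕℚ a) (fromℕℚ (suc n)) (unit n))
        (trans (cong (fromℕℚ a *_) (suc*unit n)) (*-identityʳ (fromℕℚ a))))))

  a≤a² : ∀ a → fromℕℚ a ≤ fromℕℚ a * fromℕℚ a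
  a≤a² zero    = ≤-refl
  a≤a² (suc a) = subst (fromℕℚ (suc a) ≤_) (fromℕℚ-* (suc a) (suc a))
    (fromℕℚ-mono (ℕₚ.m≤m*n (suc a) (suc a)))

  square-above : ∀ t u → q ≤ t → 0ℚ < u → 0ℚ ≤ t → t ≤ t * t → q < (t + u) * (t + u)
  square-above t u q≤t 0<u 0≤t t≤t² = ≤-<-trans (≤-trans q≤t t≤t²)
    (subst₂ _<_ (+-identityʳ (t * t))
      (solve 2 (λ t u → t :* t :+ (u :* u :+ (t :* u :+ t :* u)) := (t :+ u) :* (t :+ u)) refl t u)
      (+-monoʳ-< (t * t) (+-mono-<-≤ (0<* 0<u 0<u) (0≤+ (0≤* 0≤t (<⇒≤ 0<u)) (0≤* 0≤t (<⇒≤ 0<u))))))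

sqrt-continuous : ∀ {s t u η a b} → 0ℚ ≤ t → 0ℚ ≤ u → 0ℚ ≤ η →
  s ≡ 0ℚ ⊎ s * s ≤ a → b < (t + u) * (t + u) → a ≤ b + η * η → s ≤ (t + u) + η
sqrt-continuous {s} {t} {u} {η} {a} {b} 0≤t 0≤u 0≤η s-below t-above a≤b+η²
  with s ≤? (t + u) + η | s-below
... | yes s≤ | _        = s≤
... | no  _  | inj₁ eq  = subst (_≤ (t + u) + η) (sym eq) (0≤+ (0≤+ 0≤t 0≤u) 0≤η)
... | no  s≰ | inj₂ s²≤a = ⊥-elim (<-irrefl refl (begin-strict
  s * s                                 ≤⟨ s²≤a ⟩
  a                                     ≤⟨ a≤b+η² ⟩
  b + η * η                             <⟨ +-monoˡ-< (η * η) t-above ⟩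
  (t + u) * (t + u) + η * η             ≤⟨ ≤-by ((t + u) * η + (t + u) * η) (0≤+ (0≤* 0≤v 0≤η) (0≤* 0≤v 0≤η))
                                             (solve 2 (λ v η → (v :+ η) :* (v :+ η) := (v :* v :+ η :* η) :+ (v :* η :+ v :* η)) refl (t + u) η) ⟩
  ((t + u) + η) * ((t + u) + η)         ≤⟨ *-mono₂ (0≤+ 0≤v 0≤η) (≤-trans (0≤+ 0≤v 0≤η) (<⇒≤ (≰⇒> s≰))) (<⇒≤ (≰⇒> s≰)) (<⇒≤ (≰⇒> s≰)) ⟩
  s * s                                 ∎))
  where
  open ≤-Reasoning
  0≤v : 0ℚ ≤ t + u
  0≤v = 0≤+ 0≤t 0≤u

√_ : ℝ → ℝ
√ x = mkℝ s λ ε 0<ε →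
  let N , close = cauchy x (ε * ½ * (ε * ½)) (0<* (half 0<ε) (half 0<ε))
      M , small = unit→0 (half 0<ε)
  in N ℕ.+ M , λ m n ≤m ≤n →
    let N≤m = ℕₚ.m+n≤o⇒m≤o N ≤m
        N≤n = ℕₚ.m+n≤o⇒m≤o N ≤n
        M≤m = ℕₚ.m+n≤o⇒n≤o N ≤m
        M≤n = ℕₚ.m+n≤o⇒n≤o N ≤n
    in ∣∣-≤ (one-sided (half 0<ε) m n (close m n N≤m N≤n) (small n M≤n))
         (subst (_≤ ε) (-[p-q] (s n) (s m)) (one-sided (half 0<ε) n m (close n m N≤n N≤m) (small m M≤m)))
  where
  s : ℕ → ℚ
  s n = sqrtApprox n (seq x n)

  -[p-q] : ∀ p q → p - q ≡ - (q - p)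
  -[p-q] = solve 2 (λ p q → p :- q := :- (q :- p)) refl

  close⇒≤ : ∀ {a b η} → ℚ.∣ a - b ∣ ≤ η → a ≤ b + η
  close⇒≤ {a} {b} {η} le = ≤-by (η - (a - b)) (0≤- (≤-trans (p≤∣p∣ (a - b)) le))
    (solve 3 (λ a b η → b :+ η := a :+ (η :- (a :- b))) refl a b η)

  rearrange : ∀ p q u η ε → p ≤ (q + u) + η → u ≤ η → η + η ≡ ε → p - q ≤ ε
  rearrange p q u η ε p≤ u≤η refl = ≤-by ((((q + u) + η) - p) + (η - u)) (0≤+ (0≤- p≤) (0≤- u≤η))
    (solve 4 (λ p q u η → η :+ η := (p :- q) :+ ((((q :+ u) :+ η) :- p) :+ (η :- u))) refl p q u η)

  one-sided : ∀ {ε} → 0ℚ < ε * ½ → ∀ m n →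
    ℚ.∣ seq x m - seq x n ∣ ≤ ε * ½ * (ε * ½) → unit n ≤ ε * ½ → s m - s n ≤ ε
  one-sided {ε} 0<η m n close small = rearrange (s m) (s n) (unit n) (ε * ½) ε
    (sqrt-continuous (0≤sqrtApprox n (seq x n)) (<⇒≤ (0<unit n)) (<⇒≤ 0<η)
      (sqrtApprox-below m (seq x m)) (sqrtApprox-above n (seq x n)) (close⇒≤ close))
    small (half+half ε)

^-nonNeg : ∀ {r} → 0ℚ ≤ r → ∀ n → 0ℚ ≤ r ^ n
^-nonNeg 0≤r zero    = 0≤1
^-nonNeg 0≤r (suc n) = 0≤* 0≤r (^-nonNeg 0≤r n)

bernoulli : ∀ {r} → 0ℚ ≤ r → r < 1ℚ → ∀ n → r ^ n * (1ℚ + fromℕℚ n * (1ℚ - r)) ≤ 1ℚ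
bernoulli {r} 0≤r r<1 zero = ≤-reflexive (trans (*-identityˡ _)
  (trans (cong (λ t → 1ℚ + t) (*-zeroˡ (1ℚ - r))) (+-identityʳ 1ℚ)))
bernoulli {r} 0≤r r<1 (suc n) = ≤-trans
  (subst (λ t → r ^ suc n * (1ℚ + t * (1ℚ - r)) ≤ r ^ n * (1ℚ + fromℕℚ n * (1ℚ - r)))
    (sym (fromℕℚ-suc n)) (step (r ^ n) (fromℕℚ n) (^-nonNeg 0≤r n) (0≤fromℕℚ n)))
  (bernoulli 0≤r r<1 n)
  where
  0≤d : 0ℚ ≤ 1ℚ - r
  0≤d = 0≤- (<⇒≤ r<1)

  step : ∀ p t → 0ℚ ≤ p → 0ℚ ≤ t → (r * p) * (1ℚ + (1ℚ + t) * (1ℚ - r)) ≤ p * (1ℚ + t * (1ℚ - r))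
  step p t 0≤p 0≤t = ≤-by (p * ((1ℚ - r) * (1ℚ - r) * (1ℚ + t)))
    (0≤* 0≤p (0≤* (0≤* 0≤d 0≤d) (0≤+ 0≤1 0≤t)))
    (solve 3 (λ r p t → p :* (con 1ℚ :+ t :* (con 1ℚ :- r)) :=
       (r :* p) :* (con 1ℚ :+ (con 1ℚ :+ t) :* (con 1ℚ :- r)) :+
       p :* ((con 1ℚ :- r) :* (con 1ℚ :- r) :* (con 1ℚ :+ t))) refl r p t)

geometric⇒cauchy : ∀ {x r C} → 0ℚ ≤ r → r < 1ℚ → 0ℚ < C →
  (∀ n → ℚ.∣ x (suc n) - x n ∣ ≤ C * r ^ n) → IsCauchy x
geometric⇒cauchy {x} {r} {C} 0≤r r<1 0<C increment ε 0<ε =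
  let N , large = archimedean C (0<* (0<* 0<d 0<d) 0<ε)
  in suc N , λ m n N<m N<n → case ℕₚ.≤-total n m of λ where
    (inj₁ n≤m) → close n m N<n n≤m (large n (ℕₚ.<⇒≤ N<n))
    (inj₂ m≤n) → subst (_≤ ε) (∣-∣-sym (x n) (x m)) (close m n N<m m≤n (large m (ℕₚ.<⇒≤ N<m)))
  where
  open ≤-Reasoning

  d : ℚ
  d = 1ℚ - r

  0<d : 0ℚ < d
  0<d = subst (_< d) (+-inverseʳ r) (+-monoˡ-< (- r) r<1)

  telescope : ∀ p q s → ℚ.∣ p - s ∣ ≤ ℚ.∣ p - q ∣ + ℚ.∣ q - s ∣
  telescope p q s = subst (λ t → ℚ.∣ t ∣ ≤ ℚ.∣ p - q ∣ + ℚ.∣ q - s ∣)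
    (solve 3 (λ p q s → (p :- q) :+ (q :- s) := p :- s) refl p q s)
    (∣p+q∣≤∣p∣+∣q∣ (p - q) (q - s))

  tail-step : ∀ {g h p q s} → p ≤ g + h → g ≤ C * s → h * d ≤ C * (q - s) → p * d ≤ C * (q - r * s)
  tail-step {g} {h} {p} {q} {s} p≤ g≤ hd≤ = begin
    p * d                      ≤⟨ *-monoʳ-≤-nonNeg d ⦃ ℚ.nonNegative (<⇒≤ 0<d) ⦄ p≤ ⟩
    (g + h) * d                ≡⟨ *-distribʳ-+ d g h ⟩
    g * d + h * d              ≤⟨ +-mono-≤ (*-monoʳ-≤-nonNeg d ⦃ ℚ.nonNegative (<⇒≤ 0<d) ⦄ g≤) hd≤ ⟩
    C * s * d + C * (q - s)    ≡⟨ solve 4 (λ C s q r → C :* s :* (con 1ℚ :- r) :+ C :* (q :- s) := C :* (q :- r :* s)) refl C s q r ⟩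
    C * (q - r * s)            ∎

  tail : ∀ n k → ℚ.∣ x (k ℕ.+ n) - x n ∣ * d ≤ C * (r ^ n - r ^ (k ℕ.+ n))
  tail n zero = ≤-reflexive (trans
    (trans (cong (λ t → ℚ.∣ t ∣ * d) (+-inverseʳ (x n))) (*-zeroˡ d))
    (sym (trans (cong (C *_) (+-inverseʳ (r ^ n))) (*-zeroʳ C))))
  tail n (suc k) = tail-step {q = r ^ n} {s = r ^ (k ℕ.+ n)} (telescope (x (suc k ℕ.+ n)) (x (k ℕ.+ n)) (x n))
    (increment (k ℕ.+ n)) (tail n k)

  estimate : ∀ {e p q t} → 0ℚ ≤ p → 0ℚ ≤ q → 0ℚ < t → e * d ≤ C * (p - q) →
    p * (1ℚ + t * d) ≤ 1ℚ → C ≤ t * (d * d * ε) → e ≤ ε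
  estimate {e} {p} {q} {t} 0≤p 0≤q 0<t ed≤ bern C≤ = *-cancelʳ-≤-pos (d * (t * d)) ⦃ ℚ.positive (0<* 0<d (0<* 0<t 0<d)) ⦄ (begin
    e * (d * (t * d))        ≡⟨ *-assoc e d (t * d) ⟨
    e * d * (t * d)          ≤⟨ *-monoʳ-≤-nonNeg (t * d) ⦃ ℚ.nonNegative 0≤td ⦄ ed≤ ⟩
    C * (p - q) * (t * d)    ≤⟨ ≤-by (C * (q * (t * d) + p)) (0≤* (<⇒≤ 0<C) (0≤+ (0≤* 0≤q 0≤td) 0≤p))
                                  (solve 4 (λ C p q v → C :* (p :* (con 1ℚ :+ v)) := C :* (p :- q) :* v :+ C :* (q :* v :+ p)) refl C p q (t * d)) ⟩
    C * (p * (1ℚ + t * d))   ≤⟨ *-monoˡ-≤-nonNeg C ⦃ ℚ.nonNegative (<⇒≤ 0<C) ⦄ bern ⟩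
    C * 1ℚ                   ≡⟨ *-identityʳ C ⟩
    C                        ≤⟨ C≤ ⟩
    t * (d * d * ε)          ≡⟨ solve 3 (λ t d ε → t :* (d :* d :* ε) := ε :* (d :* (t :* d))) refl t d ε ⟩
    ε * (d * (t * d))        ∎)
    where
    0≤td : 0ℚ ≤ t * d
    0≤td = 0≤* (<⇒≤ 0<t) (<⇒≤ 0<d)

  0<fromℕℚ : ∀ {N n} → N ℕ.< n → 0ℚ < fromℕℚ n
  0<fromℕℚ N<n = <-≤-trans 0<1 (fromℕℚ-mono (ℕₚ.≤-trans (s≤s z≤n) N<n))

  close : ∀ {N} n m → N ℕ.< n → n ℕ.≤ m → C ≤ fromℕℚ n * (d * d * ε) → ℚ.∣ x m - x n ∣ ≤ ε
  close n m N<n n≤m C≤ = subst (λ k → ℚ.∣ x k - x n ∣ ≤ ε) (ℕₚ.m∸n+n≡m n≤m)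
    (estimate (^-nonNeg 0≤r n) (^-nonNeg 0≤r (m ℕ.∸ n ℕ.+ n)) (0<fromℕℚ N<n)
      (tail n (m ℕ.∸ n)) (bernoulli 0≤r r<1 n) C≤)

-- Σ_{j<n} z^(2j+1) / (2j+1), a partial sum of the Taylor series of artanh z.
artanhSum : ℚ → ℕ → ℚ
artanhSum z zero    = 0ℚ
artanhSum z (suc n) = artanhSum z n + z ^ suc (2 ℕ.* n) * (+ 1 / suc (2 ℕ.* n))

2ℚ : ℚ
2ℚ = + 2 / 1

cayley : (q : ℚ) → .(0ℚ < q) → ℚ
cayley q 0<q = (q - 1ℚ) * (1/ (q + 1ℚ)) ⦃ pos⇒nonZero (q + 1ℚ) ⦃ ℚ.positive (+-mono-< 0<q 0<1) ⦄ ⦄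

∣cayley∣<1 : ∀ q .(0<q : 0ℚ < q) → ℚ.∣ cayley q 0<q ∣ < 1ℚ
∣cayley∣<1 q 0<q′ = begin-strict
  ℚ.∣ (q - 1ℚ) * w ∣      ≡⟨ ∣p*q∣≡∣p∣*∣q∣ (q - 1ℚ) w ⟩
  ℚ.∣ q - 1ℚ ∣ * ℚ.∣ w ∣  ≡⟨ cong (ℚ.∣ q - 1ℚ ∣ *_) (0≤p⇒∣p∣≡p (<⇒≤ 0<w)) ⟩
  ℚ.∣ q - 1ℚ ∣ * w        <⟨ *-monoˡ-<-pos w ⦃ ℚ.positive 0<w ⦄ ∣q-1∣<q+1 ⟩
  (q + 1ℚ) * w            ≡⟨ *-inverseʳ (q + 1ℚ) ⟩
  1ℚ                      ∎
  where
  open ≤-Reasoning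

  0<q : 0ℚ < q
  0<q = recompute (0ℚ <? q) 0<q′

  instance
    q+1-pos : Positive (q + 1ℚ)
    q+1-pos = ℚ.positive (+-mono-< 0<q 0<1)
    q+1-nonZero : ℚ.NonZero (q + 1ℚ)
    q+1-nonZero = pos⇒nonZero (q + 1ℚ)

  w : ℚ
  w = 1/ (q + 1ℚ)

  0<w : 0ℚ < w
  0<w = positive⁻¹ w ⦃ 1/pos⇒pos (q + 1ℚ) ⦄

  ∣q-1∣<q+1 : ℚ.∣ q - 1ℚ ∣ < q + 1ℚ
  ∣q-1∣<q+1 with ∣p∣≡p∨∣p∣≡-p (q - 1ℚ)
  ... | inj₁ eq = subst (_< q + 1ℚ) (sym eq) (+-monoʳ-< q (neg<pos (- 1ℚ) 1ℚ))
  ... | inj₂ eq = subst (_< q + 1ℚ)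
    (sym (trans eq (solve 1 (λ q → :- (q :- con 1ℚ) := :- q :+ con 1ℚ) refl q)))
    (+-monoˡ-< 1ℚ (<-trans (neg-antimono-< 0<q) 0<q))

^-double : ∀ z n → z ^ (2 ℕ.* n) ≡ (z * z) ^ n
^-double z zero    = refl
^-double z (suc n) = trans (cong (λ k → z * z ^ k) (ℕₚ.+-suc n (n ℕ.+ 0)))
  (trans (sym (*-assoc z z (z ^ (2 ℕ.* n)))) (cong (z * z *_) (^-double z n)))

0≤square : ∀ z → 0ℚ ≤ z * z
0≤square z with ≤-total 0ℚ z
... | inj₁ 0≤z = 0≤* 0≤z 0≤z
... | inj₂ z≤0 = subst (0ℚ ≤_) (solve 1 (λ z → (:- z) :* (:- z) := z :* z) refl z)
  (0≤* (neg-antimono-≤ z≤0) (neg-antimono-≤ z≤0))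

square<1 : ∀ z → ℚ.∣ z ∣ < 1ℚ → z * z < 1ℚ
square<1 z ∣z∣<1 = begin-strict
  z * z              ≡⟨ 0≤p⇒∣p∣≡p (0≤square z) ⟨
  ℚ.∣ z * z ∣        ≡⟨ ∣p*q∣≡∣p∣*∣q∣ z z ⟩
  ℚ.∣ z ∣ * ℚ.∣ z ∣  ≤⟨ *-mono₂ (0≤∣p∣ z) 0≤1 (<⇒≤ ∣z∣<1) ≤-refl ⟩
  1ℚ * ℚ.∣ z ∣       ≡⟨ *-identityˡ ℚ.∣ z ∣ ⟩
  ℚ.∣ z ∣            <⟨ ∣z∣<1 ⟩
  1ℚ                 ∎
  where open ≤-Reasoning

artanhTerm-bound : ∀ z w n → ℚ.∣ z ∣ ≤ 1ℚ → 0ℚ ≤ w → w ≤ 1ℚ →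
  ℚ.∣ z ^ suc (2 ℕ.* n) * w ∣ ≤ (z * z) ^ n
artanhTerm-bound z w n ∣z∣≤1 0≤w w≤1 = begin
  ℚ.∣ z * z ^ (2 ℕ.* n) * w ∣              ≡⟨ cong (λ t → ℚ.∣ z * t * w ∣) (^-double z n) ⟩
  ℚ.∣ z * p * w ∣                          ≡⟨ ∣p*q∣≡∣p∣*∣q∣ (z * p) w ⟩
  ℚ.∣ z * p ∣ * ℚ.∣ w ∣                    ≡⟨ cong₂ _*_ (∣p*q∣≡∣p∣*∣q∣ z p) (0≤p⇒∣p∣≡p 0≤w) ⟩
  ℚ.∣ z ∣ * ℚ.∣ p ∣ * w                    ≡⟨ cong (λ t → ℚ.∣ z ∣ * t * w) (0≤p⇒∣p∣≡p 0≤p) ⟩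
  ℚ.∣ z ∣ * p * w                          ≤⟨ *-mono₂ 0≤w (0≤* 0≤1 0≤p) (*-mono₂ 0≤p 0≤1 ∣z∣≤1 ≤-refl) w≤1 ⟩
  1ℚ * p * 1ℚ                              ≡⟨ trans (*-identityʳ (1ℚ * p)) (*-identityˡ p) ⟩
  p                                        ∎
  where
  open ≤-Reasoning
  p : ℚ
  p = (z * z) ^ n
  0≤p : 0ℚ ≤ p
  0≤p = ^-nonNeg (0≤square z) n

artanhSum-increment : ∀ z → ℚ.∣ z ∣ ≤ 1ℚ → ∀ n →
  ℚ.∣ 2ℚ * artanhSum z (suc n) - 2ℚ * artanhSum z n ∣ ≤ 2ℚ * (z * z) ^ n
artanhSum-increment z ∣z∣≤1 n = scale (artanhSum z n) (z ^ suc (2 ℕ.* n) * unit (2 ℕ.* n))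
  (artanhTerm-bound z (unit (2 ℕ.* n)) n ∣z∣≤1 (<⇒≤ (0<unit (2 ℕ.* n))) (unit≤1 (2 ℕ.* n)))
  where
  scale : ∀ s t {b} → ℚ.∣ t ∣ ≤ b → ℚ.∣ 2ℚ * (s + t) - 2ℚ * s ∣ ≤ 2ℚ * b
  scale s t ∣t∣≤b = subst (_≤ _)
    (sym (trans (cong ℚ.∣_∣ (solve 3 (λ c s t → c :* (s :+ t) :- c :* s := c :* t) refl 2ℚ s t))
      (∣p*q∣≡∣p∣*∣q∣ 2ℚ t)))
    (*-monoˡ-≤-nonNeg 2ℚ ∣t∣≤b)

-- log q = 2 artanh ((q - 1) / (q + 1)) for every q > 0; artanh is given by its
-- Taylor series, which converges since |(q - 1) / (q + 1)| < 1.
log : (q : ℚ) → .(0ℚ < q) → ℝ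
log q 0<q = mkℝ (λ n → 2ℚ * artanhSum z n)
  (geometric⇒cauchy {x = λ n → 2ℚ * artanhSum z n} {r = z * z} {C = 2ℚ} (0≤square z) (square<1 z ∣z∣<1) (positive⁻¹ 2ℚ)
    (artanhSum-increment z (<⇒≤ ∣z∣<1)))
  where
  z : ℚ
  z = cayley q 0<q
  ∣z∣<1 : ℚ.∣ z ∣ < 1ℚ
  ∣z∣<1 = ∣cayley∣<1 q 0<q

artanhSum-lower : ∀ {z} → 0ℚ ≤ z → ∀ n → 1 ℕ.≤ n → artanhSum z 1 ≤ artanhSum z n
artanhSum-lower 0≤z (suc zero) _ = ≤-refl
artanhSum-lower {z} 0≤z (suc (suc n)) _ = ≤-trans (artanhSum-lower 0≤z (suc n) (s≤s z≤n))
  (≤-by (z ^ suc (2 ℕ.* suc n) * unit (2 ℕ.* suc n))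
    (0≤* (^-nonNeg 0≤z (suc (2 ℕ.* suc n))) (<⇒≤ (0<unit (2 ℕ.* suc n)))) refl)

1<q⇒0<q : ∀ {q} → 1ℚ < q → 0ℚ < q
1<q⇒0<q = <-trans 0<1

log-pos : ∀ {q} (1<q : 1ℚ < q) → 0ℝ <ℝ log q (1<q⇒0<q 1<q)
log-pos {q} 1<q = 2ℚ * artanhSum z 1 , 0<* (positive⁻¹ 2ℚ) 0<first , 1 , λ n 1≤n →
  subst (_≤ 2ℚ * artanhSum z n) (sym (+-identityˡ (2ℚ * artanhSum z 1)))
    (*-monoˡ-≤-nonNeg 2ℚ (artanhSum-lower (<⇒≤ 0<z) n 1≤n))
  where
  q+1-pos : Positive (q + 1ℚ)
  q+1-pos = ℚ.positive (+-mono-< (1<q⇒0<q 1<q) 0<1)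

  z : ℚ
  z = cayley q (1<q⇒0<q 1<q)

  0<z : 0ℚ < z
  0<z = 0<* (subst (_< q - 1ℚ) (+-inverseʳ 1ℚ) (+-monoˡ-< (- 1ℚ) 1<q))
    (positive⁻¹ _ ⦃ 1/pos⇒pos (q + 1ℚ) ⦃ q+1-pos ⦄ ⦄)

  0<first : 0ℚ < artanhSum z 1
  0<first = +-mono-≤-< ≤-refl (0<* (0<* 0<z 0<1) (0<unit 0))

logℕ : (n : ℕ) → .⦃ NonZero n ⦄ → ℝ
logℕ n = log (fromℕℚ n) (positive⁻¹ (fromℕℚ n) ⦃ normalize-pos n 1 ⦄)

infix 4 _⟶_
_⟶_ : ((n : ℕ) → .⦃ NonZero n ⦄ → ℝ) → ℝ → Set
a ⟶ l = ∀ η → 0ℝ <ℝ η → ∃[ N ] ∀ n → .⦃ _ : NonZero n ⦄ → N ℕ.≤ n → ∣ a n -ℝ l ∣ℝ <ℝ η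

-- Finite simple graphs with vertex set Fin n.
record Graph (n : ℕ) : Set₁ where
  field
    Adjacent  : Rel (Fin n) 0ℓ
    adjacent? : Decidable Adjacent
    symmetric : Symmetric Adjacent
    loopless  : Irreflexive _≡_ Adjacent

open Graph

-- Each edge is listed once, with its smaller endpoint first.
edgeList : ∀ {n} → Graph n → List (Fin n × Fin n)
edgeList {n} G = filter (λ (x , y) → (x Finₚ.<? y) ×-dec adjacent? G x y)
  (cartesianProduct (allFin n) (allFin n))

edgeCount : ∀ {n} → Graph n → ℕ
edgeCount G = length (edgeList G)

Edge : ∀ {n} → Graph n → Set
Edge G = Fin (edgeCount G)

module _ {n : ℕ} (G : Graph n) where

  source target : Edge G → Fin n
  source e = proj₁ (lookup (edgeList G) e)
  target e = proj₂ (lookup (edgeList G) e)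

  Incident : Fin n → Edge G → Set
  Incident v e = v ≡ source e ⊎ v ≡ target e

  record NonEmptySubgraph : Set where
    field
      vertices : Subset n
      edges    : Subset (edgeCount G)
      closed   : ∀ {e} → e ∈ edges → source e ∈ vertices × target e ∈ vertices
      nonEmpty : NonZero ∣ vertices ∣

    density : ℚ
    density = (+ ∣ edges ∣ / ∣ vertices ∣) ⦃ nonEmpty ⦄

  open NonEmptySubgraph

  IsMaximumDensity : ℚ → Set
  IsMaximumDensity ρ = (∃[ H ] density H ≡ ρ) × (∀ H → density H ≤ ρ)

  LocalPartition : ℕ → Set
  LocalPartition k = (v : Fin n) (e : Edge G) → Incident v e → Fin k

  module _ {k : ℕ} (c : LocalPartition k) where

    IsConflictColoring : (Fin n → Fin k) → Set
    IsConflictColoring φ = ∀ e →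
      ¬ (φ (source e) ≡ c (source e) e (inj₁ refl) × φ (target e) ≡ c (target e) e (inj₂ refl))

    ConflictColorable : Set
    ConflictColorable = ∃[ φ ] IsConflictColoring φ

    conflictColorable? : Dec ConflictColorable
    conflictColorable? = map′
      (λ (i , coloring) → finToFun i , coloring)
      (λ (φ , coloring) → funToFin φ , λ e (s , t) → coloring e
        (trans (sym (finToFun-funToFin φ (source e))) s , trans (sym (finToFun-funToFin φ (target e))) t))
      (any? {n = k ℕ.^ n} λ i → all? λ e →
        ¬? ((finToFun i (source e) Finₚ.≟ c (source e) e (inj₁ refl)) ×-dec
            (finToFun i (target e) Finₚ.≟ c (target e) e (inj₂ refl))))

  -- finToFun and remQuot identify Outcome k with the set of all functions
  -- Edge G → Fin k × Fin k; the uniform distribution on it makes the pairs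
  -- assigned to the edges independent and uniform.
  Outcome : ℕ → Set
  Outcome k = Fin ((k ℕ.* k) ℕ.^ edgeCount G)

  pairAt : ∀ {k} → Outcome k → Edge G → Fin k × Fin k
  pairAt {k} ω e = remQuot k (finToFun ω e)

  localPartition : ∀ {k} → Outcome k → LocalPartition k
  localPartition {k} ω v e (inj₁ _) = proj₁ (pairAt {k} ω e)
  localPartition {k} ω v e (inj₂ _) = proj₂ (pairAt {k} ω e)

-- The probability of P under the uniform distribution on Fin N.
probability : ∀ {N} .⦃ _ : NonZero N ⦄ {P : U.Pred (Fin N) 0ℓ} → U.Decidable P → ℚ
probability {N} P? = + length (filter P? (allFin N)) / N

probabilityConflictColorable : ∀ {n} → Graph n → (k : ℕ) → .⦃ NonZero k ⦄ → ℚ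
probabilityConflictColorable G k =
  probability ⦃ ℕₚ.m^n≢0 (k ℕ.* k) (edgeCount G) ⦃ ℕₚ.m*n≢0 k k ⦄ ⦄
    (λ ω → conflictColorable? G (localPartition G {k} ω))

{-# OPTIONS --safe #-}
-- Colour the vertices greedily in decreasing order, giving x the first colour c for
-- which no edge e = xy to a larger vertex y has c_x(e) = c and c_y(e) = φ(y). The
-- colours φ(y) do not depend on the pairs chosen for these edges, so each of the edges
-- forbids a given colour with probability 1/k². Although the events that the individual
-- colours are forbidden are dependent, all of them occur with probability at most qᵏ,
-- where q = 1 - (1 - 1/k²)ⁿ bounds the probability of one, and a union bound over the
-- vertices gives failure probability at most n qᵏ. As δ may be any constant, δ = 63 makes
-- n / k² a small multiple of log n; then 1 - q is at least a small negative power of n,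
-- and n qᵏ → 0.
module Submission where

open import Defs
open import Algebra.Bundles using (CommutativeRing)
import Algebra.Definitions.RawSemiring
import Algebra.Properties.Semiring.Exp
import Algebra.Properties.Semiring.Sum
open import Data.Bool using (true; false; if_then_else_)
open import Data.Empty using (⊥-elim)
open import Data.Fin as Fin using (Fin; zero; suc; _↑ˡ_; _↑ʳ_; combine; remQuot; finToFun; toℕ)
import Data.Fin.Properties as Finₚ
open import Data.Fin.Subset using (Subset; inside; outside; _∈_; _∉_; ∣_∣; _─_; ⊤; ⊥) renaming (_-_ to _∖_)
open import Data.Fin.Subset.Properties using (nonempty?; Empty-unique; ∣⊥∣≡0; ∣⊤∣≡n; p─⊥≡p; p─q⊆p)
open import Data.Integer as ℤ using (+_)
import Data.Integer.Properties as ℤₚ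
open import Data.List as List using (List; []; _∷_; length; filter; cartesianProduct)
open import Data.List.Membership.Propositional.Properties using (∈-lookup)
import Data.List.Properties as Listₚ
import Data.List.Relation.Unary.All as All
open import Data.List.Relation.Unary.All.Properties using (all-filter)
open import Data.Nat as ℕ using (ℕ; zero; suc; NonZero; z≤n; s≤s)
import Data.Nat.DivMod as ℕ
import Data.Nat.Properties as ℕₚ
open import Data.Product using (∃-syntax; Σ-syntax; _×_; _,_; proj₁; proj₂)
open import Data.Product.Properties using (,-injective)
open import Data.Rational as ℚ using (ℚ; 0ℚ; 1ℚ; ½; _+_; _*_; _-_; _≤_; _<_; _/_; _⊔_; toℚᵘ)
open import Data.Rational.Properties
open import Data.Rational.Solver using (module +-*-Solver)
import Data.Rational.Unnormalised as ℚᵘ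
import Data.Rational.Unnormalised.Properties as ℚᵘₚ
open import Data.Sum using (_⊎_; inj₁; inj₂)
open import Data.Vec using (Vec; []; _∷_; lookup; tabulate; here; there)
open import Data.Vec.Properties using (tabulate-cong; lookup∘tabulate; []=⇒lookup; lookup⇒[]=)
open import Function using (_∘_)
open import Level using (0ℓ)
open import Relation.Binary.PropositionalEquality
open import Relation.Nullary using (¬_; yes; no; does)
open import Relation.Nullary.Decidable using (dec-true)
open import Relation.Unary as U using (Pred)

open Algebra.Definitions.RawSemiring ℚ.+-*-rawSemiring using (_^_)
open Algebra.Properties.Semiring.Exp (CommutativeRing.semiring +-*-commutativeRing) using (^-assocʳ)
open Algebra.Properties.Semiring.Sum (CommutativeRing.semiring +-*-commutativeRing) using (sum; sum-cong-≗; *-distribˡ-sum; ∑-distrib-+)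
open +-*-Solver using (solve; _:=_; _:+_; _:*_; :-_; _:-_; con)
open ℝ

-- The dependence between colours is favourable: one pair forbids at most one colour, so the
-- removals caused by one edge are mutually exclusive. An induction over the edges with the
-- potential q^|T| exploits this without any correlation inequality. No exponential function enters
-- the estimates. The size of n is measured by R = 2^t with R^8 ≤ n < (2R)^8, which makes a power of
-- n and its logarithm available as natural numbers, and Bernoulli's inequality takes the place of
-- bounds on e^x. Put s = t + 1 and let K be the number of colours. Then K² s ≥ 8 n gives 1 - q ≥ 1
-- / (2R), which is of order n^(-1/8), while K is at least of order n^(7/16). This leaves so much
-- room that decay of degree 4 in K (1 - q) is enough: n q^K ≤ 64 / R².

^-monoˡ-≤ : ∀ {a b} → 0ℚ ≤ a → a ≤ b → ∀ n → a ^ n ≤ b ^ n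
^-monoˡ-≤ 0≤a a≤b zero    = ≤-refl
^-monoˡ-≤ 0≤a a≤b (suc n) = *-mono₂ (^-nonNeg 0≤a n) (≤-trans 0≤a a≤b) a≤b (^-monoˡ-≤ 0≤a a≤b n)

x∉p-x : ∀ {n} (p : Subset n) x → x ∉ p ∖ x
x∉p-x (s ∷ p) zero    ()
x∉p-x (s ∷ p) (suc x) (there x∈) = x∉p-x p x x∈

-- Finite sums, means and expectations

sum-mono : ∀ {n} {f g : Fin n → ℚ} → (∀ i → f i ≤ g i) → sum f ≤ sum g
sum-mono {zero}  f≤g = ≤-refl
sum-mono {suc n} f≤g = +-mono-≤ (f≤g zero) (sum-mono (f≤g ∘ suc))

0≤sum : ∀ {n} {f : Fin n → ℚ} → (∀ i → 0ℚ ≤ f i) → 0ℚ ≤ sum f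
0≤sum {zero}  0≤f = ≤-refl
0≤sum {suc n} 0≤f = 0≤+ (0≤f zero) (0≤sum (0≤f ∘ suc))

≤sum : ∀ {n} {f : Fin n → ℚ} → (∀ i → 0ℚ ≤ f i) → ∀ i → f i ≤ sum f
≤sum {f = f} 0≤f zero    = ≤-by (sum (f ∘ suc)) (0≤sum (0≤f ∘ suc)) refl
≤sum {f = f} 0≤f (suc i) = ≤-trans (≤sum (0≤f ∘ suc) i)
  (≤-by (f zero) (0≤f zero) (+-comm (f zero) (sum (f ∘ suc))))

sum-const : ∀ n x → sum {n} (λ _ → x) ≡ fromℕℚ n * x
sum-const zero    x = sym (*-zeroˡ x)
sum-const (suc n) x = begin
  x + sum {n} (λ _ → x)  ≡⟨ cong (λ t → x + t) (sum-const n x) ⟩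
  x + fromℕℚ n * x       ≡⟨ solve 2 (λ a x → x :+ a :* x := (con 1ℚ :+ a) :* x) refl (fromℕℚ n) x ⟩
  (1ℚ + fromℕℚ n) * x    ≡⟨ cong (_* x) (fromℕℚ-suc n) ⟨
  fromℕℚ (suc n) * x     ∎
  where open ≡-Reasoning

sum-if≟ : ∀ {n} (i : Fin n) a b →
  sum (λ j → if does (j Finₚ.≟ i) then a else b) ≡ fromℕℚ n * b + (a - b)
sum-if≟ {suc n} zero a b = begin
  a + sum {n} (λ _ → b)              ≡⟨ cong (λ t → a + t) (sum-const n b) ⟩
  a + fromℕℚ n * b                   ≡⟨ solve 3 (λ n a b → a :+ n :* b := (con 1ℚ :+ n) :* b :+ (a :- b)) refl (fromℕℚ n) a b ⟩
  (1ℚ + fromℕℚ n) * b + (a - b)    ≡⟨ cong (λ t → t * b + (a - b)) (fromℕℚ-suc n) ⟨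
  fromℕℚ (suc n) * b + (a - b)     ∎
  where open ≡-Reasoning
sum-if≟ {suc n} (suc i) a b = begin
  b + sum (λ j → if does (j Finₚ.≟ i) then a else b)  ≡⟨ cong (λ t → b + t) (sum-if≟ i a b) ⟩
  b + (fromℕℚ n * b + (a - b))                      ≡⟨ solve 3 (λ n a b → b :+ (n :* b :+ (a :- b)) := (con 1ℚ :+ n) :* b :+ (a :- b)) refl (fromℕℚ n) a b ⟩
  (1ℚ + fromℕℚ n) * b + (a - b)                     ≡⟨ cong (λ t → t * b + (a - b)) (fromℕℚ-suc n) ⟨
  fromℕℚ (suc n) * b + (a - b)                      ∎
  where open ≡-Reasoning

opaque
  -- Kept opaque so that the nested means in `expect` do not unfold into products and sums;
  -- `mean-sum` exposes the formula where it is needed.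
  mean : ∀ {k} → (Fin (suc k) → ℚ) → ℚ
  mean {k} f = unit k * sum f

  mean-cong : ∀ {k} {f g : Fin (suc k) → ℚ} → (∀ i → f i ≡ g i) → mean f ≡ mean g
  mean-cong {k} f≗g = cong (unit k *_) (sum-cong-≗ f≗g)

  mean-mono : ∀ {k} {f g : Fin (suc k) → ℚ} → (∀ i → f i ≤ g i) → mean f ≤ mean g
  mean-mono {k} f≤g = *-monoˡ-≤-nonNeg (unit k) ⦃ ℚ.nonNegative (<⇒≤ (0<unit k)) ⦄ (sum-mono f≤g)

  mean-+ : ∀ {k} (f g : Fin (suc k) → ℚ) → mean (λ i → f i + g i) ≡ mean f + mean g
  mean-+ {k} f g = trans (cong (unit k *_) (∑-distrib-+ f g)) (*-distribˡ-+ (unit k) (sum f) (sum g))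

  mean-* : ∀ {k} x (f : Fin (suc k) → ℚ) → mean (λ i → x * f i) ≡ x * mean f
  mean-* {k} x f = trans (cong (unit k *_) (sym (*-distribˡ-sum x f)))
    (solve 3 (λ u x s → u :* (x :* s) := x :* (u :* s)) refl (unit k) x (sum f))

  mean-const : ∀ k x → mean {k} (λ _ → x) ≡ x
  mean-const k x = begin
    unit k * sum {suc k} (λ _ → x)      ≡⟨ cong (unit k *_) (sum-const (suc k) x) ⟩
    unit k * (fromℕℚ (suc k) * x)       ≡⟨ *-swap (unit k) (fromℕℚ (suc k)) x ⟩
    (fromℕℚ (suc k) * unit k) * x       ≡⟨ cong (_* x) (suc*unit k) ⟩
    1ℚ * x                              ≡⟨ *-identityˡ x ⟩
    x                                   ∎
    where open ≡-Reasoning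

  mean-if≟ : ∀ {k} (i : Fin (suc k)) a b →
    mean (λ j → if does (j Finₚ.≟ i) then a else b) ≡ (1ℚ - unit k) * b + unit k * a
  mean-if≟ {k} i a b = begin
    unit k * sum (λ j → if does (j Finₚ.≟ i) then a else b)
      ≡⟨ cong (unit k *_) (sum-if≟ i a b) ⟩
    unit k * (fromℕℚ (suc k) * b + (a - b))
      ≡⟨ solve 4 (λ u n a b → u :* (n :* b :+ (a :- b)) := (n :* u :- u) :* b :+ u :* a) refl (unit k) (fromℕℚ (suc k)) a b ⟩
    (fromℕℚ (suc k) * unit k - unit k) * b + unit k * a
      ≡⟨ cong (λ t → (t - unit k) * b + unit k * a) (suc*unit k) ⟩
    (1ℚ - unit k) * b + unit k * a ∎
    where open ≡-Reasoning

  mean-sum : ∀ {k} (f : Fin (suc k) → ℚ) → mean f ≡ unit k * sum f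
  mean-sum f = refl

-- There are suc k colours, since unit k = 1 / suc k.
Assignment : ℕ → ℕ → Set
Assignment k m = Vec (Fin (suc k) × Fin (suc k)) m

-- An iterated mean rather than an average over `Outcome`, so that an induction can average over the
-- pair of one edge at a time. `sum-assignment` identifies the two.
expect : ∀ {k} m → (Assignment k m → ℚ) → ℚ
expect zero    F = F []
expect (suc m) F = mean λ c → mean λ d → expect m λ ω → F ((c , d) ∷ ω)

expect-cong : ∀ {k} m {F G : Assignment k m → ℚ} → (∀ ω → F ω ≡ G ω) → expect m F ≡ expect m G
expect-cong zero    F≗G = F≗G []
expect-cong (suc m) F≗G = mean-cong λ c → mean-cong λ d → expect-cong m λ ω → F≗G ((c , d) ∷ ω)

expect-mono : ∀ {k} m {F G : Assignment k m → ℚ} → (∀ ω → F ω ≤ G ω) → expect m F ≤ expect m G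
expect-mono zero    F≤G = F≤G []
expect-mono (suc m) F≤G = mean-mono λ c → mean-mono λ d → expect-mono m λ ω → F≤G ((c , d) ∷ ω)

expect-+ : ∀ {k} m (F G : Assignment k m → ℚ) → expect m (λ ω → F ω + G ω) ≡ expect m F + expect m G
expect-+ zero    F G = refl
expect-+ {k} (suc m) F G = trans
  (mean-cong λ c → trans (mean-cong λ d → expect-+ m (λ ω → F ((c , d) ∷ ω)) (λ ω → G ((c , d) ∷ ω))) (mean-+ {k} _ _))
  (mean-+ {k} _ _)

expect-* : ∀ {k} m x (F : Assignment k m → ℚ) → expect m (λ ω → x * F ω) ≡ x * expect m F
expect-* zero    x F = refl
expect-* {k} (suc m) x F = trans
  (mean-cong λ c → trans (mean-cong λ d → expect-* m x (λ ω → F ((c , d) ∷ ω))) (mean-* {k} x _))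
  (mean-* {k} x _)

expect-const : ∀ k m x → expect {k} m (λ _ → x) ≡ x
expect-const k zero    x = refl
expect-const k (suc m) x = trans
  (mean-cong {k} λ c → trans (mean-cong {k} λ d → expect-const k m x) (mean-const k x))
  (mean-const k x)

expect-sum : ∀ {k} m {n} (F : Fin n → Assignment k m → ℚ) →
  expect m (λ ω → sum (λ i → F i ω)) ≡ sum (λ i → expect m (F i))
expect-sum m {zero}  F = expect-const _ m 0ℚ
expect-sum m {suc n} F = trans (expect-+ m (F zero) (λ ω → sum (λ i → F (suc i) ω)))
  (cong (λ t → expect m (F zero) + t) (expect-sum m (F ∘ suc)))

expect-mean : ∀ {k} m {l} (F : Fin (suc l) → Assignment k m → ℚ) →
  expect m (λ ω → mean (λ i → F i ω)) ≡ mean (λ i → expect m (F i))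
expect-mean m {l} F = begin
  expect m (λ ω → mean (λ i → F i ω))          ≡⟨ expect-cong m (λ ω → mean-sum (λ i → F i ω)) ⟩
  expect m (λ ω → unit l * sum (λ i → F i ω))  ≡⟨ expect-* m (unit l) (λ ω → sum (λ i → F i ω)) ⟩
  unit l * expect m (λ ω → sum (λ i → F i ω))  ≡⟨ cong (unit l *_) (expect-sum m F) ⟩
  unit l * sum (λ i → expect m (F i))          ≡⟨ mean-sum (λ i → expect m (F i)) ⟨
  mean (λ i → expect m (F i))                  ∎
  where open ≡-Reasoning

-- The colours of T that remain for x, where S is the set of edges e = xy considered,
-- ω e = (c_x(e) , c_y(e)), and y has colour h e.
uncovered : ∀ {k m} → Subset (suc k) → Subset m → Assignment k m → (Fin m → Fin (suc k)) → Subset (suc k)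
uncovered T []            []            h = T
uncovered T (outside ∷ S) (a ∷ ω)       h = uncovered T S ω (h ∘ suc)
uncovered T (inside ∷ S)  ((c , d) ∷ ω) h = uncovered (if does (d Finₚ.≟ h zero) then T ∖ c else T) S ω (h ∘ suc)

-- This locality is behind both the stabilisation of the greedy colours and their independence of
-- the pairs at the edges leaving a smaller vertex.
uncovered-cong : ∀ {k m} T (S : Subset m) {ω ω′ : Assignment k m} {h h′ : Fin m → Fin (suc k)} →
  (∀ e → e ∈ S → lookup ω e ≡ lookup ω′ e) → (∀ e → e ∈ S → h e ≡ h′ e) →
  uncovered T S ω h ≡ uncovered T S ω′ h′
uncovered-cong T [] {[]} {[]} ω≗ω′ h≗h′ = refl
uncovered-cong T (outside ∷ S) {_ ∷ _} {_ ∷ _} ω≗ω′ h≗h′ =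
  uncovered-cong T S (λ e e∈S → ω≗ω′ (suc e) (there e∈S)) (λ e e∈S → h≗h′ (suc e) (there e∈S))
uncovered-cong T (inside ∷ S) {(c , d) ∷ ω} {_ ∷ ω′} {h} {h′} ω≗ω′ h≗h′ with refl ← ω≗ω′ zero here = trans
  (uncovered-cong _ S (λ e e∈S → ω≗ω′ (suc e) (there e∈S)) (λ e e∈S → h≗h′ (suc e) (there e∈S)))
  (cong (λ y → uncovered (if does (d Finₚ.≟ y) then T ∖ c else T) S ω′ (h′ ∘ suc)) (h≗h′ zero here))

∈uncovered : ∀ {k m} T (S : Subset m) (ω : Assignment k m) h {x} → x ∈ uncovered T S ω h →
  x ∈ T × (∀ e → e ∈ S → lookup ω e ≢ (x , h e))
∈uncovered T [] [] h x∈ = x∈ , λ ()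
∈uncovered T (outside ∷ S) (a ∷ ω) h x∈ with ∈uncovered T S ω (h ∘ suc) x∈
... | x∈T , missed = x∈T , λ { (suc e) (there e∈S) → missed e e∈S }
∈uncovered T (inside ∷ S) ((c , d) ∷ ω) h x∈ with d Finₚ.≟ h zero
... | no d≢ = let x∈T , missed = ∈uncovered T S ω (h ∘ suc) x∈ in
  x∈T , λ { zero _ eq → d≢ (proj₂ (,-injective eq)) ; (suc e) (there e∈S) → missed e e∈S }
... | yes _ = let x∈T-c , missed = ∈uncovered (T ∖ c) S ω (h ∘ suc) x∈ in
  p─q⊆p T _ x∈T-c , λ
    { zero _ eq → x∉p-x T c (subst (_∈ T ∖ c) (sym (proj₁ (,-injective eq))) x∈T-c)
    ; (suc e) (there e∈S) → missed e e∈S }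

-- If each colour is removed from T with probability w, at most one at a time, the
-- expectation of q ^ ∣ T ∣ is at most what it would be for independent removals.
potential : ∀ {k} (T : Subset k) {q w} → 0ℚ ≤ q → q ≤ 1ℚ → 0ℚ ≤ w →
  q ^ ∣ T ∣ + w * sum (λ c → q ^ ∣ T ∖ c ∣ - q ^ ∣ T ∣) ≤ (q + w * (1ℚ - q)) ^ ∣ T ∣
potential [] {q} {w} 0≤q q≤1 0≤w = ≤-reflexive (trans (cong (λ t → 1ℚ + t) (*-zeroʳ w)) (+-identityʳ 1ℚ))
potential (outside ∷ T) {q} {w} 0≤q q≤1 0≤w = subst (_≤ (q + w * (1ℚ - q)) ^ ∣ T ∣)
  (cong (λ s → q ^ ∣ T ∣ + w * s) (sym (begin
    (q ^ ∣ T ─ ⊥ ∣ - q ^ ∣ T ∣) + Δ  ≡⟨ cong (λ U → (q ^ ∣ U ∣ - q ^ ∣ T ∣) + Δ) (p─⊥≡p T) ⟩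
    (q ^ ∣ T ∣ - q ^ ∣ T ∣) + Δ  ≡⟨ cong (_+ Δ) (+-inverseʳ (q ^ ∣ T ∣)) ⟩
    0ℚ + Δ ≡⟨ +-identityˡ Δ ⟩
    Δ ∎)))
  (potential T 0≤q q≤1 0≤w)
  where
  open ≡-Reasoning
  Δ : ℚ
  Δ = sum (λ c → q ^ ∣ T ∖ c ∣ - q ^ ∣ T ∣)
potential (inside ∷ T) {q} {w} 0≤q q≤1 0≤w = begin
  q * g + w * ((q ^ ∣ T ─ ⊥ ∣ - q * g) + sum (λ c → q * q ^ ∣ T ∖ c ∣ - q * g))
    ≡⟨ cong₂ (λ U s → q * g + w * ((q ^ ∣ U ∣ - q * g) + s)) (p─⊥≡p T) (trans (sum-cong-≗ λ c →
         solve 3 (λ q g f → q :* f :- q :* g := q :* (f :- g)) refl q g (q ^ ∣ T ∖ c ∣)) (sym (*-distribˡ-sum q (λ c → q ^ ∣ T ∖ c ∣ - g)))) ⟩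
  q * g + w * ((g - q * g) + q * Δ)
    ≡⟨ solve 4 (λ q w g Δ → q :* g :+ w :* ((g :- q :* g) :+ q :* Δ) := q :* (g :+ w :* Δ) :+ (w :* (con 1ℚ :- q)) :* g) refl q w g Δ ⟩
  q * (g + w * Δ) + (w * (1ℚ - q)) * g
    -- With independent removals the second summand would already carry r ^ ∣ T ∣. Exclusive
    -- removals leave the rest of T intact when the first colour goes, hence g, which is smaller
    -- because q ≤ r.
    ≤⟨ +-mono-≤ (*-monoˡ-≤-nonNeg q ⦃ ℚ.nonNegative 0≤q ⦄ (potential T 0≤q q≤1 0≤w))
         (*-monoˡ-≤-nonNeg (w * (1ℚ - q)) ⦃ ℚ.nonNegative 0≤wq ⦄ (^-monoˡ-≤ 0≤q q≤r ∣ T ∣)) ⟩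
  q * r ^ ∣ T ∣ + (w * (1ℚ - q)) * r ^ ∣ T ∣
    ≡⟨ *-distribʳ-+ (r ^ ∣ T ∣) q (w * (1ℚ - q)) ⟨
  r * r ^ ∣ T ∣ ∎
  where
  open ≤-Reasoning
  g Δ r : ℚ
  g = q ^ ∣ T ∣
  Δ = sum (λ c → q ^ ∣ T ∖ c ∣ - q ^ ∣ T ∣)
  r = q + w * (1ℚ - q)
  0≤wq : 0ℚ ≤ w * (1ℚ - q)
  0≤wq = 0≤* 0≤w (0≤- q≤1)
  q≤r : q ≤ r
  q≤r = ≤-by (w * (1ℚ - q)) 0≤wq refl

-- Independence without probability: on `S` the colours are a function of the pairs outside `S`, so
-- the pairs on `S` can be averaged with these colours held fixed.
IndependentOf : ∀ {k m} → Subset m → (Assignment k m → Fin m → Fin (suc k)) → Set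
IndependentOf S h = ∀ ω ω′ → (∀ e → e ∉ S → lookup ω e ≡ lookup ω′ e) → ∀ e → e ∈ S → h ω e ≡ h ω′ e

0≤^≤1 : ∀ {p} → 0ℚ ≤ p → p ≤ 1ℚ → ∀ n → 0ℚ ≤ p ^ n × p ^ n ≤ 1ℚ
0≤^≤1 0≤p p≤1 zero    = 0≤1 , ≤-refl
0≤^≤1 0≤p p≤1 (suc n) = let 0≤ , ≤1 = 0≤^≤1 0≤p p≤1 n in 0≤* 0≤p 0≤ , *-mono₂ 0≤ 0≤1 p≤1 ≤1

0≤1-≤1 : ∀ {p} → 0ℚ ≤ p → p ≤ 1ℚ → 0ℚ ≤ 1ℚ - p × 1ℚ - p ≤ 1ℚ
0≤1-≤1 {p} 0≤p p≤1 = 0≤- p≤1 , ≤-by p 0≤p (solve 1 (λ p → con 1ℚ := (con 1ℚ :- p) :+ p) refl p)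

0≤unit² : ∀ k → 0ℚ ≤ unit k * unit k
0≤unit² k = 0≤square (unit k)

unit²≤1 : ∀ k → unit k * unit k ≤ 1ℚ
unit²≤1 k = *-mono₂ (<⇒≤ (0<unit k)) 0≤1 (unit≤1 k) (unit≤1 k)

^-antitone : ∀ {p} → 0ℚ ≤ p → p ≤ 1ℚ → ∀ {i j} → i ℕ.≤ j → p ^ j ≤ p ^ i
^-antitone 0≤p p≤1 {j = j} z≤n = proj₂ (0≤^≤1 0≤p p≤1 j)
^-antitone {p} 0≤p p≤1 (s≤s i≤j) = *-monoˡ-≤-nonNeg p ⦃ ℚ.nonNegative 0≤p ⦄ (^-antitone 0≤p p≤1 i≤j)

-- The probability that at least one of i edges forbids a given colour, when the colours of the
-- other endpoints are fixed.
hitProbability : ℕ → ℕ → ℚ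
hitProbability k i = 1ℚ - (1ℚ - unit k * unit k) ^ i

0≤hitProbability≤1 : ∀ k i → 0ℚ ≤ hitProbability k i × hitProbability k i ≤ 1ℚ
0≤hitProbability≤1 k i =
  let 0≤1-w , 1-w≤1 = 0≤1-≤1 (0≤unit² k) (unit²≤1 k)
      0≤p , p≤1 = 0≤^≤1 0≤1-w 1-w≤1 i
  in 0≤1-≤1 0≤p p≤1

-- One more edge changes q into q + w (1 - q) with w = 1 / (k + 1)², exactly the base on the
-- right-hand side of `potential`.
hitProbability-suc : ∀ k i → hitProbability k (suc i) ≡
  hitProbability k i + unit k * unit k * (1ℚ - hitProbability k i)
hitProbability-suc k i = solve 2 (λ w p → con 1ℚ :- (con 1ℚ :- w) :* p :=
  (con 1ℚ :- p) :+ w :* (con 1ℚ :- (con 1ℚ :- p))) refl (unit k * unit k) ((1ℚ - unit k * unit k) ^ i)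

-- 0ℚ ^ j is the indicator of j = 0.
expect-uncovered : ∀ {k m} (S : Subset m) (T : Subset (suc k)) (h : Assignment k m → Fin m → Fin (suc k)) →
  IndependentOf S h → expect m (λ ω → 0ℚ ^ ∣ uncovered T S ω (h ω) ∣) ≤ hitProbability k ∣ S ∣ ^ ∣ T ∣
expect-uncovered [] T h ind = ≤-refl
expect-uncovered {k} {suc m} (outside ∷ S) T h ind = ≤-trans
  (mean-mono λ c → mean-mono λ d → expect-uncovered S T (λ ω e → h ((c , d) ∷ ω) (suc e))
    λ ω ω′ agree e e∈S → ind ((c , d) ∷ ω) ((c , d) ∷ ω′)
      (λ { zero _ → refl ; (suc e) e∉ → agree e (e∉ ∘ there) }) (suc e) (there e∈S))
  (≤-reflexive (trans (mean-cong {k} λ c → mean-const k _) (mean-const k _)))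
expect-uncovered {k} {suc m} (inside ∷ S) T h ind = begin
  mean (λ c → mean λ d → expect m λ ω → 0ℚ ^ ∣ uncovered (if does (d Finₚ.≟ h ((c , d) ∷ ω) zero) then T ∖ c else T) S ω (λ e → h ((c , d) ∷ ω) (suc e)) ∣)
    ≡⟨ mean-cong {k} (λ c → begin-equality
         mean (λ d → expect m λ ω → 0ℚ ^ ∣ uncovered (if does (d Finₚ.≟ h ((c , d) ∷ ω) zero) then T ∖ c else T) S ω (λ e → h ((c , d) ∷ ω) (suc e)) ∣)
           ≡⟨ mean-cong {k} (λ d → expect-cong m λ ω → trans
                (cong (λ y → 0ℚ ^ ∣ uncovered (if does (d Finₚ.≟ y) then T ∖ c else T) S ω (λ e → h ((c , d) ∷ ω) (suc e)) ∣) (same c d ω zero here))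
                (trans (cong (λ U → 0ℚ ^ ∣ U ∣) (uncovered-cong (if does (d Finₚ.≟ h₀ ω zero) then T ∖ c else T) S {ω} (λ _ _ → refl) (λ e e∈S → same c d ω (suc e) (there e∈S))))
                  (push-if (does (d Finₚ.≟ h₀ ω zero)) (λ U → left U ω)))) ⟩
         mean (λ d → expect m λ ω → if does (d Finₚ.≟ h₀ ω zero) then left (T ∖ c) ω else left T ω)
           -- The colour that d has to meet depends on ω, so the mean over d is moved inside the
           -- expectation over ω.
           ≡⟨ expect-mean m (λ d ω → if does (d Finₚ.≟ h₀ ω zero) then left (T ∖ c) ω else left T ω) ⟨
         expect m (λ ω → mean λ d → if does (d Finₚ.≟ h₀ ω zero) then left (T ∖ c) ω else left T ω)
           ≡⟨ expect-cong m (λ ω → mean-if≟ (h₀ ω zero) (left (T ∖ c) ω) (left T ω)) ⟩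
         expect m (λ ω → (1ℚ - u) * left T ω + u * left (T ∖ c) ω)
           ≡⟨ expect-+ m (λ ω → (1ℚ - u) * left T ω) (λ ω → u * left (T ∖ c) ω) ⟩
         expect m (λ ω → (1ℚ - u) * left T ω) + expect m (λ ω → u * left (T ∖ c) ω)
           ≡⟨ cong₂ _+_ (expect-* m (1ℚ - u) (left T)) (expect-* m u (left (T ∖ c))) ⟩
         (1ℚ - u) * expect m (left T) + u * expect m (left (T ∖ c)) ∎) ⟩
  mean (λ c → (1ℚ - u) * expect m (left T) + u * expect m (left (T ∖ c)))
    ≤⟨ mean-mono {k} (λ c → +-mono-≤
         (*-monoˡ-≤-nonNeg (1ℚ - u) ⦃ ℚ.nonNegative (0≤- (unit≤1 k)) ⦄ (bound T))
         (*-monoˡ-≤-nonNeg u ⦃ ℚ.nonNegative (<⇒≤ (0<unit k)) ⦄ (bound (T ∖ c)))) ⟩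
  mean (λ c → (1ℚ - u) * q ^ ∣ T ∣ + u * q ^ ∣ T ∖ c ∣)
    ≡⟨ mean-cong {k} (λ c → solve 3 (λ u g f → (con 1ℚ :- u) :* g :+ u :* f := g :+ u :* (f :- g)) refl u (q ^ ∣ T ∣) (q ^ ∣ T ∖ c ∣)) ⟩
  mean (λ c → q ^ ∣ T ∣ + u * (q ^ ∣ T ∖ c ∣ - q ^ ∣ T ∣))
    ≡⟨ trans (mean-+ {k} _ _) (cong₂ _+_ (mean-const k (q ^ ∣ T ∣)) (trans (mean-* {k} u _) (cong (u *_) (mean-sum {k} _)))) ⟩
  q ^ ∣ T ∣ + u * (u * sum (λ c → q ^ ∣ T ∖ c ∣ - q ^ ∣ T ∣))
    ≡⟨ cong (λ t → q ^ ∣ T ∣ + t) (*-assoc u u _) ⟨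
  q ^ ∣ T ∣ + u * u * sum (λ c → q ^ ∣ T ∖ c ∣ - q ^ ∣ T ∣)
    ≤⟨ potential T (proj₁ 0≤q≤1) (proj₂ 0≤q≤1) (0≤unit² k) ⟩
  (q + u * u * (1ℚ - q)) ^ ∣ T ∣
    ≡⟨ cong (_^ ∣ T ∣) (hitProbability-suc k ∣ S ∣) ⟨
  hitProbability k (suc ∣ S ∣) ^ ∣ T ∣ ∎
  where
  open ≤-Reasoning
  u q : ℚ
  u = unit k
  q = hitProbability k ∣ S ∣
  0≤q≤1 = 0≤hitProbability≤1 k ∣ S ∣

  h₀ : Assignment k m → Fin (suc m) → Fin (suc k)
  h₀ ω = h ((zero , zero) ∷ ω)

  same : ∀ c d ω e → e ∈ inside ∷ S → h ((c , d) ∷ ω) e ≡ h₀ ω e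
  same c d ω = ind ((c , d) ∷ ω) ((zero , zero) ∷ ω) λ { zero 0∉ → ⊥-elim (0∉ here) ; (suc e) _ → refl }

  left : Subset (suc k) → Assignment k m → ℚ
  left U ω = 0ℚ ^ ∣ uncovered U S ω (h₀ ω ∘ suc) ∣

  push-if : ∀ b {U V : Subset (suc k)} (f : Subset (suc k) → ℚ) → f (if b then U else V) ≡ (if b then f U else f V)
  push-if true  f = refl
  push-if false f = refl

  bound : ∀ U → expect m (left U) ≤ q ^ ∣ U ∣
  bound U = expect-uncovered S U (λ ω → h₀ ω ∘ suc) λ ω ω′ agree e e∈S → ind ((zero , zero) ∷ ω) ((zero , zero) ∷ ω′)
    (λ { zero _ → refl ; (suc e) e∉ → agree e (e∉ ∘ there) }) (suc e) (there e∈S)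

-- From expectations to probabilities of outcomes

fromℕℚ-cancel-≤ : ∀ {m n} → fromℕℚ m ≤ fromℕℚ n → m ℕ.≤ n
fromℕℚ-cancel-≤ {m} {n} m≤n with m ℕ.≤? n
... | yes p = p
... | no  p = ⊥-elim (<-irrefl refl (begin-strict
  fromℕℚ n         ≡⟨ +-identityˡ (fromℕℚ n) ⟨
  0ℚ + fromℕℚ n    <⟨ +-monoˡ-< (fromℕℚ n) 0<1 ⟩
  1ℚ + fromℕℚ n    ≡⟨ fromℕℚ-suc n ⟨
  fromℕℚ (suc n)   ≤⟨ fromℕℚ-mono (ℕₚ.≰⇒> p) ⟩
  fromℕℚ m         ≤⟨ m≤n ⟩
  fromℕℚ n         ∎))
  where open ≤-Reasoning

/-*-cancel : ∀ m n .⦃ _ : NonZero n ⦄ → (+ m / n) * fromℕℚ n ≡ fromℕℚ m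
/-*-cancel m n@(suc n-1) = toℚᵘ-injective (begin
  toℚᵘ ((+ m / n) * fromℕℚ n)               ≈⟨ toℚᵘ-homo-* (+ m / n) (fromℕℚ n) ⟩
  toℚᵘ (+ m / n) ℚᵘ.* toℚᵘ (fromℕℚ n)       ≈⟨ ℚᵘₚ.*-cong (toℚᵘ-fromℚᵘ (ℚᵘ.mkℚᵘ (+ m) n-1)) (toℚᵘ-fromℚᵘ (ℚᵘ.mkℚᵘ (+ n) 0)) ⟩
  ℚᵘ.mkℚᵘ (+ m) n-1 ℚᵘ.* ℚᵘ.mkℚᵘ (+ n) 0    ≈⟨ ℚᵘ.*≡* (trans (ℤₚ.*-identityʳ (+ m ℤ.* + n)) (cong (λ d → + m ℤ.* + suc d) (sym (ℕₚ.*-identityʳ n-1)))) ⟩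
  ℚᵘ.mkℚᵘ (+ m) 0                           ≈⟨ toℚᵘ-fromℚᵘ (ℚᵘ.mkℚᵘ (+ m) 0) ⟨
  toℚᵘ (fromℕℚ m)                           ∎)
  where open ℚᵘₚ.≃-Reasoning

sum-↑ : ∀ a {b} (f : Fin (a ℕ.+ b) → ℚ) → sum f ≡ sum (λ i → f (i ↑ˡ b)) + sum (λ j → f (a ↑ʳ j))
sum-↑ zero    f = sym (+-identityˡ (sum f))
sum-↑ (suc a) f = trans (cong (λ t → f zero + t) (sum-↑ a (f ∘ suc))) (sym (+-assoc (f zero) _ _))

sum-combine : ∀ a {b} (f : Fin (a ℕ.* b) → ℚ) → sum f ≡ sum {a} (λ i → sum {b} (λ j → f (combine i j)))
sum-combine zero        f = refl
sum-combine (suc a) {b} f = trans (sum-↑ b f) (cong (λ t → sum (λ j → f (j ↑ˡ (a ℕ.* b))) + t) (sum-combine a (λ i → f (b ↑ʳ i))))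

sum≡*mean : ∀ {k} (f : Fin (suc k) → ℚ) → sum f ≡ fromℕℚ (suc k) * mean f
sum≡*mean {k} f = begin
  sum f                                   ≡⟨ *-identityˡ (sum f) ⟨
  1ℚ * sum f                              ≡⟨ cong (_* sum f) (suc*unit k) ⟨
  fromℕℚ (suc k) * unit k * sum f         ≡⟨ *-assoc (fromℕℚ (suc k)) (unit k) (sum f) ⟩
  fromℕℚ (suc k) * (unit k * sum f)       ≡⟨ cong (fromℕℚ (suc k) *_) (mean-sum f) ⟨
  fromℕℚ (suc k) * mean f                 ∎
  where open ≡-Reasoning

assignment : ∀ {k m} → Fin ((suc k ℕ.* suc k) ℕ.^ m) → Assignment k m
assignment {k} {m} ω = tabulate λ e → remQuot (suc k) (finToFun {suc k ℕ.* suc k} {m} ω e)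

assignment-combine : ∀ {k m} (c d : Fin (suc k)) (ω : Fin ((suc k ℕ.* suc k) ℕ.^ m)) →
  assignment {k} {suc m} (combine (combine c d) ω) ≡ (c , d) ∷ assignment {k} {m} ω
assignment-combine {k} {m} c d ω = cong₂ _∷_
  (trans (cong (remQuot (suc k) ∘ proj₁) eq) (Finₚ.remQuot-combine c d))
  (tabulate-cong λ e → cong (λ qr → remQuot (suc k) (finToFun {suc k ℕ.* suc k} {m} (proj₂ qr) e)) eq)
  where
  eq : remQuot {suc k ℕ.* suc k} ((suc k ℕ.* suc k) ℕ.^ m) (combine (combine c d) ω) ≡ (combine c d , ω)
  eq = Finₚ.remQuot-combine (combine c d) ω

-- `finToFun` reads an outcome as a string of digits in base (k + 1)², and each digit is itself a
-- pair of digits in base k + 1. Splitting off the leading digit with `combine` matches one step of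
-- `expect`.
sum-assignment : ∀ k m (F : Assignment k m → ℚ) →
  sum (λ ω → F (assignment {k} {m} ω)) ≡ fromℕℚ ((suc k ℕ.* suc k) ℕ.^ m) * expect m F
sum-assignment k zero    F = trans (+-identityʳ (F [])) (sym (*-identityˡ (F [])))
sum-assignment k (suc m) F = begin
  sum (λ ω → F (assignment {k} {suc m} ω))
    ≡⟨ sum-combine (suc k ℕ.* suc k) {N} (λ ω → F (assignment {k} {suc m} ω)) ⟩
  sum {suc k ℕ.* suc k} (λ a → sum {N} λ ω → F (assignment {k} {suc m} (combine a ω)))
    ≡⟨ sum-combine (suc k) {suc k} (λ a → sum {N} λ ω → F (assignment {k} {suc m} (combine a ω))) ⟩
  sum {suc k} (λ c → sum {suc k} λ d → sum {N} λ ω → F (assignment {k} {suc m} (combine (combine c d) ω)))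
    ≡⟨ sum-cong-≗ {suc k} (λ c → begin
         sum {suc k} (λ d → sum {N} λ ω → F (assignment {k} {suc m} (combine (combine c d) ω)))
           ≡⟨ sum-cong-≗ {suc k} (λ d → trans
                (sum-cong-≗ {N} λ ω → cong F (assignment-combine {k} {m} c d ω))
                (sum-assignment k m (λ ω → F ((c , d) ∷ ω)))) ⟩
         sum {suc k} (λ d → fromℕℚ N * expect m (λ ω → F ((c , d) ∷ ω)))
           ≡⟨ *-distribˡ-sum {suc k} (fromℕℚ N) (λ d → expect m (λ ω → F ((c , d) ∷ ω))) ⟨
         fromℕℚ N * sum {suc k} (λ d → expect m (λ ω → F ((c , d) ∷ ω)))
           ≡⟨ cong (fromℕℚ N *_) (sum≡*mean {k} (λ d → expect m (λ ω → F ((c , d) ∷ ω)))) ⟩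
         fromℕℚ N * (fromℕℚ (suc k) * mean (λ d → expect m (λ ω → F ((c , d) ∷ ω))))
           ≡⟨ *-assoc (fromℕℚ N) (fromℕℚ (suc k)) _ ⟨
         fromℕℚ N * fromℕℚ (suc k) * mean (λ d → expect m (λ ω → F ((c , d) ∷ ω))) ∎) ⟩
  sum {suc k} (λ c → fromℕℚ N * fromℕℚ (suc k) * mean (λ d → expect m (λ ω → F ((c , d) ∷ ω))))
    ≡⟨ *-distribˡ-sum {suc k} (fromℕℚ N * fromℕℚ (suc k)) (λ c → mean (λ d → expect m (λ ω → F ((c , d) ∷ ω)))) ⟨
  fromℕℚ N * fromℕℚ (suc k) * sum {suc k} (λ c → mean (λ d → expect m (λ ω → F ((c , d) ∷ ω))))
    ≡⟨ cong (fromℕℚ N * fromℕℚ (suc k) *_) (sum≡*mean {k} (λ c → mean (λ d → expect m (λ ω → F ((c , d) ∷ ω))))) ⟩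
  fromℕℚ N * fromℕℚ (suc k) * (fromℕℚ (suc k) * expect (suc m) F)
    ≡⟨ solve 3 (λ N K E → N :* K :* (K :* E) := (K :* K :* N) :* E) refl (fromℕℚ N) (fromℕℚ (suc k)) (expect (suc m) F) ⟩
  fromℕℚ (suc k) * fromℕℚ (suc k) * fromℕℚ N * expect (suc m) F
    ≡⟨ cong (_* expect (suc m) F) (trans (fromℕℚ-* (suc k ℕ.* suc k) N) (cong (_* fromℕℚ N) (fromℕℚ-* (suc k) (suc k)))) ⟨
  fromℕℚ ((suc k ℕ.* suc k) ℕ.^ suc m) * expect (suc m) F ∎
  where
  open ≡-Reasoning
  N : ℕ
  N = (suc k ℕ.* suc k) ℕ.^ m

length-filter-tabulate : ∀ {N} {A : Set} {P : Pred A 0ℓ} (P? : U.Decidable P) (f : Fin N → A) →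
  fromℕℚ (length (filter P? (List.tabulate f))) ≡ sum (λ i → if does (P? (f i)) then 1ℚ else 0ℚ)
length-filter-tabulate {zero}  P? f = refl
length-filter-tabulate {suc N} P? f with does (P? (f zero))
... | true  = trans (fromℕℚ-suc (length (filter P? (List.tabulate (f ∘ suc))))) (cong (λ t → 1ℚ + t) (length-filter-tabulate P? (f ∘ suc)))
... | false = trans (length-filter-tabulate P? (f ∘ suc)) (sym (+-identityˡ _))

-- Markov's inequality for the complement: F dominates the indicator of failure, so the indicator of
-- P plus F is at least 1 at every outcome.
probability-≥ : ∀ {N} .⦃ _ : NonZero N ⦄ {P : Pred (Fin N) 0ℓ} (P? : U.Decidable P) (F : Fin N → ℚ) {p} →
  (∀ ω → 0ℚ ≤ F ω) → (∀ ω → ¬ P ω → 1ℚ ≤ F ω) → sum F ≤ fromℕℚ N * p →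
  1ℚ - p ≤ probability P?
probability-≥ {suc N} P? F {p} 0≤F ¬P⇒1≤F sumF≤ = *-cancelʳ-≤-pos (fromℕℚ (suc N)) ⦃ normalize-pos (suc N) 1 ⦄ (begin
  (1ℚ - p) * fromℕℚ (suc N)
    ≡⟨ solve 2 (λ n p → (con 1ℚ :- p) :* n := n :* con 1ℚ :- n :* p) refl (fromℕℚ (suc N)) p ⟩
  fromℕℚ (suc N) * 1ℚ - fromℕℚ (suc N) * p
    ≤⟨ +-monoʳ-≤ (fromℕℚ (suc N) * 1ℚ) (neg-antimono-≤ sumF≤) ⟩
  fromℕℚ (suc N) * 1ℚ - sum F
    ≡⟨ cong (_- sum F) (sum-const (suc N) 1ℚ) ⟨
  sum {suc N} (λ _ → 1ℚ) - sum F
    ≤⟨ +-monoˡ-≤ (ℚ.- sum F) (sum-mono cover) ⟩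
  sum (λ ω → (if does (P? ω) then 1ℚ else 0ℚ) + F ω) - sum F
    ≡⟨ cong (_- sum F) (∑-distrib-+ (λ ω → if does (P? ω) then 1ℚ else 0ℚ) F) ⟩
  sum (λ ω → if does (P? ω) then 1ℚ else 0ℚ) + sum F - sum F
    ≡⟨ solve 2 (λ s t → s :+ t :- t := s) refl (sum (λ ω → if does (P? ω) then 1ℚ else 0ℚ)) (sum F) ⟩
  sum (λ ω → if does (P? ω) then 1ℚ else 0ℚ)
    ≡⟨ length-filter-tabulate P? (λ i → i) ⟨
  fromℕℚ (length (filter P? (List.allFin (suc N))))
    ≡⟨ /-*-cancel (length (filter P? (List.allFin (suc N)))) (suc N) ⟨
  probability P? * fromℕℚ (suc N) ∎)
  where
  open ≤-Reasoning
  cover : ∀ ω → 1ℚ ≤ (if does (P? ω) then 1ℚ else 0ℚ) + F ω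
  cover ω with P? ω
  ... | yes _ = ≤-by (F ω) (0≤F ω) refl
  ... | no ¬p = ≤-trans (¬P⇒1≤F ω ¬p) (≤-reflexive (sym (+-identityˡ (F ω))))

-- Sets of edges and their sizes

subset : ∀ {m} {P : Pred (Fin m) 0ℓ} → U.Decidable P → Subset m
subset P? = tabulate (does ∘ P?)

∈subset⁺ : ∀ {m} {P : Pred (Fin m) 0ℓ} (P? : U.Decidable P) {e} → P e → e ∈ subset P?
∈subset⁺ P? {e} p = lookup⇒[]= e _ (trans (lookup∘tabulate (does ∘ P?) e) (dec-true (P? e) p))

∈subset⁻ : ∀ {m} {P : Pred (Fin m) 0ℓ} (P? : U.Decidable P) {e} → e ∈ subset P? → P e
∈subset⁻ P? {e} e∈ with P? e | trans (sym (lookup∘tabulate (does ∘ P?) e)) ([]=⇒lookup e∈)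
... | yes p | _  = p
... | no _  | ()

∣subset∘lookup∣ : ∀ {A : Set} {P : Pred A 0ℓ} (P? : U.Decidable P) (xs : List A) →
  ∣ subset (λ e → P? (List.lookup xs e)) ∣ ≡ length (filter P? xs)
∣subset∘lookup∣ P? []       = refl
∣subset∘lookup∣ P? (x ∷ xs) with does (P? x)
... | true  = cong suc (∣subset∘lookup∣ P? xs)
... | false = ∣subset∘lookup∣ P? xs

length-filter-filter : ∀ {A : Set} {P Q : Pred A 0ℓ} (P? : U.Decidable P) (Q? : U.Decidable Q) xs →
  length (filter P? (filter Q? xs)) ℕ.≤ length (filter P? xs)
length-filter-filter P? Q? []       = z≤n
length-filter-filter P? Q? (x ∷ xs) with does (Q? x)
... | false with does (P? x)
...   | true  = ℕₚ.m≤n⇒m≤1+n (length-filter-filter P? Q? xs)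
...   | false = length-filter-filter P? Q? xs
length-filter-filter P? Q? (x ∷ xs) | true with does (P? x)
...   | true  = s≤s (length-filter-filter P? Q? xs)
...   | false = length-filter-filter P? Q? xs

length-filter-map-, : ∀ {A B : Set} {P : Pred A 0ℓ} (P? : U.Decidable P) x (ys : List B) →
  length (filter (P? ∘ proj₁) (List.map (x ,_) ys)) ≡ (if does (P? x) then length ys else 0)
length-filter-map-, P? x [] with does (P? x)
... | true  = refl
... | false = refl
length-filter-map-, P? x (y ∷ ys) with does (P? x) | length-filter-map-, P? x ys
... | true  | eq = cong suc eq
... | false | eq = eq

length-filter-cartesianProduct : ∀ {A B : Set} {P : Pred A 0ℓ} (P? : U.Decidable P) xs (ys : List B) →
  length (filter (P? ∘ proj₁) (cartesianProduct xs ys)) ≡ length (filter P? xs) ℕ.* length ys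
length-filter-cartesianProduct P? []       ys = refl
length-filter-cartesianProduct P? (x ∷ xs) ys = begin
  length (filter (P? ∘ proj₁) (List.map (x ,_) ys List.++ cartesianProduct xs ys))
    ≡⟨ cong length (Listₚ.filter-++ (P? ∘ proj₁) (List.map (x ,_) ys) (cartesianProduct xs ys)) ⟩
  length (filter (P? ∘ proj₁) (List.map (x ,_) ys) List.++ filter (P? ∘ proj₁) (cartesianProduct xs ys))
    ≡⟨ Listₚ.length-++ (filter (P? ∘ proj₁) (List.map (x ,_) ys)) ⟩
  length (filter (P? ∘ proj₁) (List.map (x ,_) ys)) ℕ.+ length (filter (P? ∘ proj₁) (cartesianProduct xs ys))
    ≡⟨ cong₂ ℕ._+_ (length-filter-map-, P? x ys) (length-filter-cartesianProduct P? xs ys) ⟩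
  (if does (P? x) then length ys else 0) ℕ.+ length (filter P? xs) ℕ.* length ys
    ≡⟨ collect ⟩
  length (filter P? (x ∷ xs)) ℕ.* length ys ∎
  where
  open ≡-Reasoning
  collect : (if does (P? x) then length ys else 0) ℕ.+ length (filter P? xs) ℕ.* length ys ≡
    length (filter P? (x ∷ xs)) ℕ.* length ys
  collect with does (P? x)
  ... | true  = refl
  ... | false = refl

length-filter-≟ : ∀ {n} (x : Fin n) → length (filter (Finₚ._≟ x) (List.allFin n)) ℕ.≤ 1
length-filter-≟ {n} x = fromℕℚ-cancel-≤ (≤-reflexive (begin
  fromℕℚ (length (filter (Finₚ._≟ x) (List.allFin n)))     ≡⟨ length-filter-tabulate (Finₚ._≟ x) (λ i → i) ⟩
  sum (λ i → if does (i Finₚ.≟ x) then 1ℚ else 0ℚ)        ≡⟨ sum-if≟ x 1ℚ 0ℚ ⟩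
  fromℕℚ n * 0ℚ + (1ℚ - 0ℚ)                               ≡⟨ cong (_+ (1ℚ - 0ℚ)) (*-zeroʳ (fromℕℚ n)) ⟩
  fromℕℚ 1                                                ∎))
  where open ≡-Reasoning

-- The greedy colouring

module _ {n : ℕ} (G : Graph n) where

  -- The edges from x to larger vertices, since the source is the smaller endpoint. Distinct
  -- vertices have disjoint sets `out`, which is why the choices at x can be averaged separately.
  out : Fin n → Subset (edgeCount G)
  out x = subset (λ e → source G e Finₚ.≟ x)

  ∈out : ∀ {x e} → e ∈ out x → source G e ≡ x
  ∈out {x} = ∈subset⁻ (λ e → source G e Finₚ.≟ x)

  -- `edgeList` filters the product of the vertex list with itself, and only n pairs of that product
  -- start with x.
  ∣out∣≤n : ∀ x → ∣ out x ∣ ℕ.≤ n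
  ∣out∣≤n x = begin
    ∣ out x ∣
      ≡⟨ ∣subset∘lookup∣ ((Finₚ._≟ x) ∘ proj₁) (edgeList G) ⟩
    length (filter ((Finₚ._≟ x) ∘ proj₁) (edgeList G))
      ≤⟨ length-filter-filter ((Finₚ._≟ x) ∘ proj₁) _ (cartesianProduct (List.allFin n) (List.allFin n)) ⟩
    length (filter ((Finₚ._≟ x) ∘ proj₁) (cartesianProduct (List.allFin n) (List.allFin n)))
      ≡⟨ length-filter-cartesianProduct (Finₚ._≟ x) (List.allFin n) (List.allFin n) ⟩
    length (filter (Finₚ._≟ x) (List.allFin n)) ℕ.* length (List.allFin n)
      ≤⟨ ℕₚ.*-monoˡ-≤ (length (List.allFin n)) (length-filter-≟ x) ⟩
    1 ℕ.* length (List.allFin n)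
      ≡⟨ trans (ℕₚ.*-identityˡ _) (Listₚ.length-tabulate (λ i → i)) ⟩
    n ∎
    where open ℕₚ.≤-Reasoning

  source<target : ∀ e → source G e Fin.< target G e
  source<target e = proj₁ (All.lookup (all-filter _ (cartesianProduct (List.allFin n) (List.allFin n))) (∈-lookup {xs = edgeList G} e))

  ∈out⇒<target : ∀ {x e} → e ∈ out x → x Fin.< target G e
  ∈out⇒<target {e = e} e∈ = subst (Fin._< target G e) (∈out e∈) (source<target e)

  module _ {k : ℕ} where

    free : Assignment k (edgeCount G) → (Fin n → Fin (suc k)) → Fin n → Subset (suc k)
    free ω φ x = uncovered ⊤ (out x) ω (φ ∘ target G)

    pick : Subset (suc k) → Fin (suc k)
    pick T with nonempty? T
    ... | yes (c , _) = c
    -- The value is arbitrary: a vertex without a free colour is counted by `failures`.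
    ... | no _        = zero

    pick-∈ : ∀ T → pick T ∈ T ⊎ ∣ T ∣ ≡ 0
    pick-∈ T with nonempty? T
    ... | yes (_ , c∈T) = inj₁ c∈T
    ... | no  empty     = inj₂ (trans (cong ∣_∣ (Empty-unique empty)) (∣⊥∣≡0 (suc k)))

    -- Vertex x receives its final colour in round n ∸ toℕ x at the latest, since it
    -- depends only on vertices greater than x.
    greedy : Assignment k (edgeCount G) → ℕ → Fin n → Fin (suc k)
    greedy ω zero    x = zero
    greedy ω (suc j) x = pick (free ω (greedy ω j) x)

    greedy-stable : ∀ ω j x → n ℕ.≤ j ℕ.+ toℕ x → greedy ω (suc j) x ≡ greedy ω j x
    greedy-stable ω zero    x n≤x = ⊥-elim (ℕₚ.<⇒≱ (Finₚ.toℕ<n x) n≤x)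
    greedy-stable ω (suc j) x n≤  = cong pick (uncovered-cong ⊤ (out x) (λ _ _ → refl) λ e e∈ →
      greedy-stable ω j (target G e) (begin
        n                            ≤⟨ n≤ ⟩
        suc j ℕ.+ toℕ x              ≡⟨ ℕₚ.+-suc j (toℕ x) ⟨
        j ℕ.+ suc (toℕ x)            ≤⟨ ℕₚ.+-monoʳ-≤ j (∈out⇒<target e∈) ⟩
        j ℕ.+ toℕ (target G e)       ∎))
      where open ℕₚ.≤-Reasoning

    -- The recursion for y follows edges to ever larger vertices, so every edge that it reads has
    -- its source above x and lies outside `out x`.
    greedy-independent : ∀ x {ω ω′} → (∀ e → e ∉ out x → lookup ω e ≡ lookup ω′ e) →
      ∀ j y → x Fin.< y → greedy ω j y ≡ greedy ω′ j y
    greedy-independent x agree zero    y x<y = refl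
    greedy-independent x agree (suc j) y x<y = cong pick (uncovered-cong ⊤ (out y)
      (λ e e∈ → agree e λ e∈x → Finₚ.<⇒≢ x<y (trans (sym (∈out e∈x)) (∈out e∈)))
      (λ e e∈ → greedy-independent x agree j (target G e)
        (Finₚ.<-trans x<y (∈out⇒<target e∈))))

    free-independent : ∀ x → IndependentOf (out x) (λ ω → greedy ω n ∘ target G)
    free-independent x ω ω′ agree e e∈ = greedy-independent x agree n (target G e)
      (∈out⇒<target e∈)

    greedy-coloring : ∀ ω → (∀ x → ∣ free ω (greedy ω n) x ∣ ≢ 0) →
      ∀ e → lookup ω e ≢ (greedy ω n (source G e) , greedy ω n (target G e))
    greedy-coloring ω nonempty e eq with pick-∈ (free ω (greedy ω n) (source G e))
    ... | inj₂ empty = nonempty (source G e) empty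
    ... | inj₁ c∈    = proj₂ (∈uncovered ⊤ (out (source G e)) ω _ c∈) e (∈subset⁺ (λ e′ → source G e′ Finₚ.≟ source G e) refl)
      -- The free colour was picked for round n + 1; `greedy-stable` identifies it with the colour
      -- of round n.
      (trans eq (cong (_, greedy ω n (target G e)) (sym (greedy-stable ω n (source G e) (ℕₚ.m≤m+n n _)))))

    failures : Assignment k (edgeCount G) → ℚ
    failures ω = sum λ x → 0ℚ ^ ∣ free ω (greedy ω n) x ∣

    0≤failure : ∀ ω x → 0ℚ ≤ 0ℚ ^ ∣ free ω (greedy ω n) x ∣
    0≤failure ω x = ^-nonNeg ≤-refl ∣ free ω (greedy ω n) x ∣

    expect-failures : expect (edgeCount G) failures ≤ fromℕℚ n * hitProbability k n ^ suc k
    expect-failures = begin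
      expect (edgeCount G) failures
        ≡⟨ expect-sum (edgeCount G) (λ x ω → 0ℚ ^ ∣ free ω (greedy ω n) x ∣) ⟩
      sum (λ x → expect (edgeCount G) λ ω → 0ℚ ^ ∣ free ω (greedy ω n) x ∣)
        ≤⟨ sum-mono (λ x → expect-uncovered (out x) ⊤ (λ ω → greedy ω n ∘ target G) (free-independent x)) ⟩
      sum (λ x → hitProbability k ∣ out x ∣ ^ ∣ ⊤ {suc k} ∣)
        ≤⟨ sum-mono (λ x → ^-monoˡ-≤ (proj₁ (0≤hitProbability≤1 k ∣ out x ∣)) (hitProbability-mono (∣out∣≤n x)) ∣ ⊤ {suc k} ∣) ⟩
      sum {n} (λ x → hitProbability k n ^ ∣ ⊤ {suc k} ∣)
        ≡⟨ sum-const n _ ⟩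
      fromℕℚ n * hitProbability k n ^ ∣ ⊤ {suc k} ∣
        ≡⟨ cong (λ j → fromℕℚ n * hitProbability k n ^ j) (∣⊤∣≡n (suc k)) ⟩
      fromℕℚ n * hitProbability k n ^ suc k ∎
      where
      open ≤-Reasoning
      hitProbability-mono : ∀ {i j} → i ℕ.≤ j → hitProbability k i ≤ hitProbability k j
      hitProbability-mono i≤j = let 0≤p , p≤1 = 0≤1-≤1 (0≤unit² k) (unit²≤1 k) in
        +-monoʳ-≤ 1ℚ (neg-antimono-≤ (^-antitone 0≤p p≤1 i≤j))

  probabilityConflictColorable-≥ : ∀ k → 1ℚ - fromℕℚ n * hitProbability k n ^ suc k ≤ probabilityConflictColorable G (suc k)
  probabilityConflictColorable-≥ k = probability-≥ ⦃ ℕₚ.m^n≢0 (suc k ℕ.* suc k) (edgeCount G) ⦄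
    (λ ω → conflictColorable? G (localPartition G {suc k} ω))
    (failures ∘ assignment {k} {edgeCount G}) (λ ω → 0≤sum (0≤failure (assignment {k} {edgeCount G} ω))) uncolorable⇒failure
    (≤-trans (≤-reflexive (sum-assignment k (edgeCount G) failures))
      (*-monoˡ-≤-nonNeg (fromℕℚ N) ⦃ ℚ.nonNegative (0≤fromℕℚ N) ⦄ expect-failures))
    where
    N : ℕ
    N = (suc k ℕ.* suc k) ℕ.^ edgeCount G

    uncolorable⇒failure : ∀ ω → ¬ ConflictColorable G (localPartition G {suc k} ω) →
      1ℚ ≤ failures (assignment {k} {edgeCount G} ω)
    uncolorable⇒failure ω ¬colorable with Finₚ.any? (λ x → ∣ free (assignment {k} {edgeCount G} ω) (greedy (assignment {k} {edgeCount G} ω) n) x ∣ ℕ.≟ 0)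
    ... | yes (x , empty) = ≤-trans (≤-reflexive (sym (cong (0ℚ ^_) empty)))
      (≤sum (0≤failure (assignment {k} {edgeCount G} ω)) x)
    ... | no  nonempty    = ⊥-elim (¬colorable (greedy ω′ n , λ e (s , t) →
      greedy-coloring ω′ (λ x empty → nonempty (x , empty)) e
        (trans (lookup∘tabulate (pairAt G {suc k} ω) e) (sym (cong₂ _,_ s t)))))
      where
      ω′ = assignment {k} {edgeCount G} ω

-- Upper bounds for the logarithm and the threshold

*-monoʳ-≤ : ∀ {a b} c → 0ℚ ≤ c → a ≤ b → c * a ≤ c * b
*-monoʳ-≤ c 0≤c = *-monoˡ-≤-nonNeg c ⦃ ℚ.nonNegative 0≤c ⦄

*-monoˡ-≤ : ∀ {a b} c → 0ℚ ≤ c → a ≤ b → a * c ≤ b * c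
*-monoˡ-≤ c 0≤c = *-monoʳ-≤-nonNeg c ⦃ ℚ.nonNegative 0≤c ⦄

*-cancelˡ-≤ : ∀ {a b} c → 0ℚ < c → c * a ≤ c * b → a ≤ b
*-cancelˡ-≤ c 0<c = *-cancelˡ-≤-pos c ⦃ ℚ.positive 0<c ⦄

unit-antitone : ∀ {m n} → m ℕ.≤ n → unit n ≤ unit m
unit-antitone {m} {n} m≤n = *-cancelˡ-≤ (fromℕℚ (suc n)) 0<n (begin
  fromℕℚ (suc n) * unit n  ≡⟨ suc*unit n ⟩
  1ℚ                       ≡⟨ suc*unit m ⟨
  fromℕℚ (suc m) * unit m  ≤⟨ *-monoˡ-≤ (unit m) (<⇒≤ (0<unit m)) (fromℕℚ-mono (s≤s m≤n)) ⟩
  fromℕℚ (suc n) * unit m  ∎)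
  where
  open ≤-Reasoning
  0<n : 0ℚ < fromℕℚ (suc n)
  0<n = <-≤-trans 0<1 (fromℕℚ-mono (s≤s (z≤n {n})))

artanhTerm : ℚ → ℕ → ℚ
artanhTerm z n = z ^ suc (2 ℕ.* n) * unit (2 ℕ.* n)

module _ {z : ℚ} (0≤z : 0ℚ ≤ z) (z≤1 : z ≤ 1ℚ) where

  0≤artanhTerm : ∀ n → 0ℚ ≤ artanhTerm z n
  0≤artanhTerm n = 0≤* (^-nonNeg 0≤z (suc (2 ℕ.* n))) (<⇒≤ (0<unit (2 ℕ.* n)))

  artanhSum-mono : ∀ i n → artanhSum z n ≤ artanhSum z (i ℕ.+ n)
  artanhSum-mono zero    n = ≤-refl
  artanhSum-mono (suc i) n = ≤-trans (artanhSum-mono i n) (≤-by (artanhTerm z (i ℕ.+ n)) (0≤artanhTerm (i ℕ.+ n)) refl)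

  0≤zz≤1 : 0ℚ ≤ z * z × z * z ≤ 1ℚ
  0≤zz≤1 = 0≤* 0≤z 0≤z , *-mono₂ 0≤z 0≤1 z≤1 z≤1

  artanhTerm-≤ : ∀ i n → artanhTerm z (i ℕ.+ n) ≤ (z * z) ^ i * unit (2 ℕ.* n)
  artanhTerm-≤ i n = *-mono₂ (<⇒≤ (0<unit (2 ℕ.* (i ℕ.+ n)))) (^-nonNeg (proj₁ 0≤zz≤1) i)
    (begin
      z * z ^ (2 ℕ.* (i ℕ.+ n))  ≡⟨ cong (z *_) (^-double z (i ℕ.+ n)) ⟩
      z * (z * z) ^ (i ℕ.+ n)    ≤⟨ *-monoˡ-≤ ((z * z) ^ (i ℕ.+ n)) (^-nonNeg (proj₁ 0≤zz≤1) (i ℕ.+ n)) z≤1 ⟩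
      1ℚ * (z * z) ^ (i ℕ.+ n)   ≡⟨ *-identityˡ _ ⟩
      (z * z) ^ (i ℕ.+ n)        ≤⟨ decreasing i ⟩
      (z * z) ^ i                ∎)
    (unit-antitone (ℕₚ.*-monoʳ-≤ 2 (ℕₚ.m≤n+m n i)))
    where
    open ≤-Reasoning
    decreasing : ∀ i → (z * z) ^ (i ℕ.+ n) ≤ (z * z) ^ i
    decreasing zero    = proj₂ (0≤^≤1 (proj₁ 0≤zz≤1) (proj₂ 0≤zz≤1) n)
    decreasing (suc i) = *-monoʳ-≤ (z * z) (proj₁ 0≤zz≤1) (decreasing i)

  artanhSum-block : ∀ i n → artanhSum z (i ℕ.+ n) ≤ artanhSum z n + fromℕℚ i * unit (2 ℕ.* n)
  artanhSum-block zero    n = ≤-reflexive (sym (trans (cong (λ t → artanhSum z n + t) (*-zeroˡ (unit (2 ℕ.* n)))) (+-identityʳ _)))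
  artanhSum-block (suc i) n = begin
    artanhSum z (i ℕ.+ n) + artanhTerm z (i ℕ.+ n)
      ≤⟨ +-mono-≤ (artanhSum-block i n) (≤-trans (artanhTerm-≤ i n)
           (*-monoˡ-≤ v (<⇒≤ (0<unit (2 ℕ.* n))) (proj₂ (0≤^≤1 (proj₁ 0≤zz≤1) (proj₂ 0≤zz≤1) i)))) ⟩
    artanhSum z n + fromℕℚ i * v + 1ℚ * v
      ≡⟨ solve 3 (λ A i v → A :+ i :* v :+ con 1ℚ :* v := A :+ (con 1ℚ :+ i) :* v) refl (artanhSum z n) (fromℕℚ i) v ⟩
    artanhSum z n + (1ℚ + fromℕℚ i) * v
      ≡⟨ cong (λ t → artanhSum z n + t * v) (fromℕℚ-suc i) ⟨
    artanhSum z n + fromℕℚ (suc i) * v ∎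
    where
    open ≤-Reasoning
    v : ℚ
    v = unit (2 ℕ.* n)

  -- As for the harmonic series, doubling the number of terms adds at most 1: the 2^b new terms are
  -- at most 1 / (2 · 2^b + 1) each.
  artanhSum-dyadic : ∀ b → artanhSum z (2 ℕ.^ b) ≤ fromℕℚ (suc b)
  artanhSum-dyadic zero    = ≤-trans (artanhSum-block 1 0) (≤-reflexive refl)
  artanhSum-dyadic (suc b) = begin
    artanhSum z (2 ℕ.^ suc b)
      ≡⟨ cong (artanhSum z) (cong (2 ℕ.^ b ℕ.+_) (ℕₚ.+-identityʳ (2 ℕ.^ b))) ⟩
    artanhSum z (2 ℕ.^ b ℕ.+ 2 ℕ.^ b)
      ≤⟨ artanhSum-block (2 ℕ.^ b) (2 ℕ.^ b) ⟩
    artanhSum z (2 ℕ.^ b) + fromℕℚ (2 ℕ.^ b) * v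
      ≤⟨ +-mono-≤ (artanhSum-dyadic b) (*-monoˡ-≤ v (<⇒≤ (0<unit (2 ℕ.* 2 ℕ.^ b)))
           (fromℕℚ-mono (ℕₚ.m≤n⇒m≤1+n (ℕₚ.m≤n*m (2 ℕ.^ b) 2)))) ⟩
    fromℕℚ (suc b) + fromℕℚ (suc (2 ℕ.* 2 ℕ.^ b)) * v
      ≡⟨ cong (λ t → fromℕℚ (suc b) + t) (suc*unit (2 ℕ.* 2 ℕ.^ b)) ⟩
    fromℕℚ (suc b) + 1ℚ
      ≡⟨ trans (+-comm (fromℕℚ (suc b)) 1ℚ) (sym (fromℕℚ-suc (suc b))) ⟩
    fromℕℚ (suc (suc b)) ∎
    where
    open ≤-Reasoning
    v : ℚ
    v = unit (2 ℕ.* 2 ℕ.^ b)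

  -- The hypothesis says g ≥ 1 / (1 - z²), so the last summand on the left dominates the
  -- remainder of the series.
  artanhSum-tail : ∀ {g} → 0ℚ ≤ g → 1ℚ + g * (z * z) ≤ g → ∀ i n →
    artanhSum z (i ℕ.+ n) + unit (2 ℕ.* n) * g * (z * z) ^ i ≤ artanhSum z n + unit (2 ℕ.* n) * g
  artanhSum-tail {g} 0≤g g-geometric zero    n = ≤-reflexive (cong (λ t → artanhSum z n + t) (*-identityʳ _))
  artanhSum-tail {g} 0≤g g-geometric (suc i) n = begin
    artanhSum z (i ℕ.+ n) + artanhTerm z (i ℕ.+ n) + v * g * (z * z * y)
      ≤⟨ +-monoˡ-≤ _ (+-monoʳ-≤ (artanhSum z (i ℕ.+ n)) (artanhTerm-≤ i n)) ⟩
    artanhSum z (i ℕ.+ n) + y * v + v * g * (z * z * y)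
      ≡⟨ solve 5 (λ A y v g w → A :+ y :* v :+ v :* g :* (w :* y) := A :+ (y :* v) :* (con 1ℚ :+ g :* w)) refl (artanhSum z (i ℕ.+ n)) y v g (z * z) ⟩
    artanhSum z (i ℕ.+ n) + (y * v) * (1ℚ + g * (z * z))
      ≤⟨ +-monoʳ-≤ (artanhSum z (i ℕ.+ n)) (*-monoʳ-≤ (y * v) (0≤* (^-nonNeg (proj₁ 0≤zz≤1) i) (<⇒≤ (0<unit (2 ℕ.* n)))) g-geometric) ⟩
    artanhSum z (i ℕ.+ n) + (y * v) * g
      ≡⟨ solve 4 (λ A y v g → A :+ (y :* v) :* g := A :+ v :* g :* y) refl (artanhSum z (i ℕ.+ n)) y v g ⟩
    artanhSum z (i ℕ.+ n) + v * g * y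
      ≤⟨ artanhSum-tail 0≤g g-geometric i n ⟩
    artanhSum z n + v * g ∎
    where
    open ≤-Reasoning
    v y : ℚ
    v = unit (2 ℕ.* n)
    y = (z * z) ^ i

cayley-* : ∀ q .(0<q : 0ℚ < q) → cayley q 0<q * (q + 1ℚ) ≡ q - 1ℚ
cayley-* q 0<q = trans (*-assoc (q - 1ℚ) _ (q + 1ℚ)) (trans (cong ((q - 1ℚ) *_) (*-inverseˡ (q + 1ℚ) ⦃ nz ⦄)) (*-identityʳ (q - 1ℚ)))
  where
  .nz : ℚ.NonZero (q + 1ℚ)
  nz = pos⇒nonZero (q + 1ℚ) ⦃ ℚ.positive (+-mono-< 0<q 0<1) ⦄

-- The series is cut after M = 2^b ≥ q terms. The head is at most b + 1 by `artanhSum-dyadic`; the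
-- tail is at most v g ≤ 1, because M is large enough to compensate for the slow convergence when z
-- is close to 1.
log-≤ : ∀ {q} (1<q : 1ℚ < q) b → q ≤ fromℕℚ (2 ℕ.^ b) → ∀ n → seq (log q (1<q⇒0<q 1<q)) n ≤ 2ℚ * fromℕℚ (2 ℕ.+ b)
log-≤ {q} 1<q b q≤ n = *-monoʳ-≤ 2ℚ (<⇒≤ (positive⁻¹ 2ℚ)) (begin
  artanhSum z n
    ≤⟨ artanhSum-mono 0≤z z≤1 M n ⟩
  artanhSum z (M ℕ.+ n)
    ≡⟨ cong (artanhSum z) (ℕₚ.+-comm M n) ⟩
  artanhSum z (n ℕ.+ M)
    ≤⟨ ≤-by (v * g * (z * z) ^ n) (0≤* (0≤* 0≤v 0≤g) (^-nonNeg (0≤* 0≤z 0≤z) n)) refl ⟩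
  artanhSum z (n ℕ.+ M) + v * g * (z * z) ^ n
    ≤⟨ artanhSum-tail 0≤z z≤1 0≤g g-geometric n M ⟩
  artanhSum z M + v * g
    ≤⟨ +-mono-≤ (artanhSum-dyadic 0≤z z≤1 b) vg≤1 ⟩
  fromℕℚ (suc b) + 1ℚ
    ≡⟨ trans (+-comm (fromℕℚ (suc b)) 1ℚ) (sym (fromℕℚ-suc (suc b))) ⟩
  fromℕℚ (suc (suc b)) ∎)
  where
  open ≤-Reasoning
  M : ℕ
  M = 2 ℕ.^ b
  z v g : ℚ
  z = cayley q (1<q⇒0<q 1<q)
  v = unit (2 ℕ.* M)
  -- This is 1 / (1 - z), and 1 / (1 - z) ≥ 1 / (1 - z²) as 0 ≤ z ≤ 1.
  g = (q + 1ℚ) * ½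

  0<q+1 : 0ℚ < q + 1ℚ
  0<q+1 = +-mono-< (1<q⇒0<q 1<q) 0<1

  0≤v : 0ℚ ≤ v
  0≤v = <⇒≤ (0<unit (2 ℕ.* M))

  0≤g : 0ℚ ≤ g
  0≤g = <⇒≤ (half 0<q+1)

  z*[q+1] : z * (q + 1ℚ) ≡ q - 1ℚ
  z*[q+1] = cayley-* q (1<q⇒0<q 1<q)

  0≤z : 0ℚ ≤ z
  0≤z = *-cancelˡ-≤ (q + 1ℚ) 0<q+1 (begin
    (q + 1ℚ) * 0ℚ  ≡⟨ *-zeroʳ (q + 1ℚ) ⟩
    0ℚ             ≤⟨ 0≤- (<⇒≤ 1<q) ⟩
    q - 1ℚ         ≡⟨ trans (*-comm (q + 1ℚ) z) z*[q+1] ⟨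
    (q + 1ℚ) * z   ∎)

  z≤1 : z ≤ 1ℚ
  z≤1 = ≤-trans (p≤∣p∣ z) (<⇒≤ (∣cayley∣<1 q (1<q⇒0<q 1<q)))

  g-geometric : 1ℚ + g * (z * z) ≤ g
  g-geometric = begin
    1ℚ + g * (z * z)             ≤⟨ +-monoʳ-≤ 1ℚ (*-monoʳ-≤ g 0≤g (≤-trans (*-monoʳ-≤ z 0≤z z≤1) (≤-reflexive (*-identityʳ z)))) ⟩
    1ℚ + g * z                   ≡⟨ solve 2 (λ q z → con 1ℚ :+ (q :+ con 1ℚ) :* con ½ :* z := con 1ℚ :+ (z :* (q :+ con 1ℚ)) :* con ½) refl q z ⟩
    1ℚ + z * (q + 1ℚ) * ½        ≡⟨ cong (λ t → 1ℚ + t * ½) z*[q+1] ⟩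
    1ℚ + (q - 1ℚ) * ½            ≡⟨ solve 1 (λ q → con 1ℚ :+ (q :- con 1ℚ) :* con ½ := (q :+ con 1ℚ) :* con ½) refl q ⟩
    g                            ∎

  vg≤1 : v * g ≤ 1ℚ
  vg≤1 = begin
    v * ((q + 1ℚ) * ½)           ≤⟨ *-monoʳ-≤ v 0≤v (≤-trans (≤-by g 0≤g (sym (half+half (q + 1ℚ)))) (≤-trans (+-monoˡ-≤ 1ℚ q≤)
                                      (≤-trans (≤-reflexive (trans (+-comm (fromℕℚ M) 1ℚ) (sym (fromℕℚ-suc M)))) (fromℕℚ-mono (s≤s (ℕₚ.m≤n*m M 2)))))) ⟩
    v * fromℕℚ (suc (2 ℕ.* M))   ≡⟨ trans (*-comm v _) (suc*unit (2 ℕ.* M)) ⟩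
    1ℚ                           ∎

1≤inverse* : ∀ x 0<x {B} → (∀ n → seq x n ≤ B) → ∃[ N ] ∀ n → N ℕ.≤ n → 1ℚ ≤ seq (inverse x 0<x) n * B
1≤inverse* x (c , 0<c , K , c≤x) {B} x≤B = K , λ n K≤n → begin
  1ℚ
    ≡⟨ *-inverseˡ (seq x n ⊔ c) ⦃ pos⇒nonZero (seq x n ⊔ c) ⦃ truncated-pos n ⦄ ⦄ ⟨
  seq (inverse x (c , 0<c , K , c≤x)) n * (seq x n ⊔ c)
    ≤⟨ *-monoʳ-≤ (seq (inverse x (c , 0<c , K , c≤x)) n) (0≤inverse n)
         (⊔-lub (x≤B n) (≤-trans (subst (_≤ seq x n) (+-identityˡ c) (c≤x n K≤n)) (x≤B n))) ⟩
  seq (inverse x (c , 0<c , K , c≤x)) n * B ∎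
  where
  open ≤-Reasoning
  truncated-pos : ∀ n → ℚ.Positive (seq x n ⊔ c)
  truncated-pos n = ℚ.positive (<-≤-trans 0<c (p≤q⊔p (seq x n) c))
  0≤inverse : ∀ n → 0ℚ ≤ seq (inverse x (c , 0<c , K , c≤x)) n
  0≤inverse n = <⇒≤ (positive⁻¹ _ ⦃ 1/pos⇒pos (seq x n ⊔ c) ⦃ truncated-pos n ⦄ ⦄)

-- The factors 2 absorb the error of the rational approximations of the square root.
square-√divide-≤ : ∀ {q y B δ k} (0<y : 0ℝ <ℝ y) → 0ℚ ≤ q → 0ℚ ≤ δ → 0ℚ ≤ B → (∀ n → seq y n ≤ B) →
  (1ℝ +ℝ fromℚ δ) *ℝ √ (divide (fromℚ q) y 0<y) ≤ℝ fromℕ (suc k) →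
  (1ℚ + δ) * (1ℚ + δ) * q ≤ (fromℕℚ 2 * fromℕℚ (suc k)) * (fromℕℚ 2 * fromℕℚ (suc k)) * B
square-√divide-≤ {q} {y} {B} {δ} {k} 0<y 0≤q 0≤δ 0≤B y≤B ≤k =
  let 0<D = +-mono-<-≤ 0<1 0≤δ
      -- The grid of the approximate root costs at most D η = ½ and the slack in `≤ℝ` another ½,
      -- together 1 ≤ K.
      η , 0<η , Dη≡½ = split-tolerance {1ℚ + δ} {½} 0<D (positive⁻¹ ½)
      L , unit≤η = unit→0 0<η
      N , close = ≤k ½ (positive⁻¹ ½)
      M , 1≤rB = 1≤inverse* y 0<y y≤B
      n = L ℕ.+ (N ℕ.+ M)
  in bound 0<D Dη≡½ (unit≤η n (ℕₚ.m≤m+n L _)) (close n (ℕₚ.≤-trans (ℕₚ.m≤m+n N M) (ℕₚ.m≤n+m _ L)))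
       (1≤rB n (ℕₚ.≤-trans (ℕₚ.m≤n+m M N) (ℕₚ.m≤n+m _ L)))
       (sqrtApprox-above n (q * seq (inverse y 0<y) n))
       (0≤sqrtApprox n (q * seq (inverse y 0<y) n)) (0<unit n)
  where
  open ≤-Reasoning
  K D : ℚ
  K = fromℕℚ (suc k)
  D = 1ℚ + δ

  bound : ∀ {η u s r} → 0ℚ < D → D * η ≡ ½ → u ≤ η → D * s ≤ K + ½ → 1ℚ ≤ r * B →
    q * r < (s + u) * (s + u) → 0ℚ ≤ s → 0ℚ < u → D * D * q ≤ (fromℕℚ 2 * K) * (fromℕℚ 2 * K) * B
  bound {η} {u} {s} {r} 0<D Dη≡½ u≤η Ds≤ 1≤rB qr< 0≤s 0<u = begin
    D * D * q                              ≡⟨ *-identityʳ (D * D * q) ⟨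
    D * D * q * 1ℚ                         ≤⟨ *-monoʳ-≤ (D * D * q) (0≤* (0≤* 0≤D 0≤D) 0≤q) 1≤rB ⟩
    D * D * q * (r * B)                    ≡⟨ solve 4 (λ D q r B → D :* D :* q :* (r :* B) := D :* D :* (q :* r) :* B) refl D q r B ⟩
    D * D * (q * r) * B                    ≤⟨ *-monoˡ-≤ B 0≤B (*-monoʳ-≤ (D * D) (0≤* 0≤D 0≤D) (<⇒≤ qr<)) ⟩
    D * D * ((s + u) * (s + u)) * B        ≡⟨ solve 3 (λ D t B → D :* D :* (t :* t) :* B := (D :* t) :* (D :* t) :* B) refl D (s + u) B ⟩
    (D * (s + u)) * (D * (s + u)) * B      ≤⟨ *-monoˡ-≤ B 0≤B (*-mono₂ 0≤D[s+u] 0≤2K D[s+u]≤2K D[s+u]≤2K) ⟩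
    (fromℕℚ 2 * K) * (fromℕℚ 2 * K) * B    ∎
    where
    0≤D : 0ℚ ≤ D
    0≤D = <⇒≤ 0<D
    0≤D[s+u] : 0ℚ ≤ D * (s + u)
    0≤D[s+u] = 0≤* 0≤D (0≤+ 0≤s (<⇒≤ 0<u))
    0≤2K : 0ℚ ≤ fromℕℚ 2 * K
    0≤2K = 0≤* (0≤fromℕℚ 2) (0≤fromℕℚ (suc k))
    D[s+u]≤2K : D * (s + u) ≤ fromℕℚ 2 * K
    D[s+u]≤2K = begin
      D * (s + u)           ≡⟨ *-distribˡ-+ D s u ⟩
      D * s + D * u         ≤⟨ +-mono-≤ Ds≤ (≤-trans (*-monoʳ-≤ D 0≤D u≤η) (≤-reflexive Dη≡½)) ⟩
      K + ½ + ½             ≡⟨ solve 1 (λ K → K :+ con ½ :+ con ½ := K :+ con 1ℚ) refl K ⟩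
      K + 1ℚ                ≤⟨ +-monoʳ-≤ K (fromℕℚ-mono (s≤s (z≤n {k}))) ⟩
      K + K                 ≡⟨ solve 1 (λ K → K :+ K := con (fromℕℚ 2) :* K) refl K ⟩
      fromℕℚ 2 * K          ∎

-- Decay of the union bound

1-*≤^ : ∀ {w} → 0ℚ ≤ w → w ≤ 1ℚ → ∀ n → 1ℚ - fromℕℚ n * w ≤ (1ℚ - w) ^ n
1-*≤^ {w} 0≤w w≤1 zero    = ≤-reflexive (solve 1 (λ w → con 1ℚ :- con 0ℚ :* w := con 1ℚ) refl w)
1-*≤^ {w} 0≤w w≤1 (suc n) = begin
  1ℚ - fromℕℚ (suc n) * w              ≡⟨ cong (λ t → 1ℚ - t * w) (fromℕℚ-suc n) ⟩
  1ℚ - (1ℚ + fromℕℚ n) * w             ≤⟨ ≤-by (fromℕℚ n * (w * w)) (0≤* (0≤fromℕℚ n) (0≤* 0≤w 0≤w))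
                                            (solve 2 (λ n w → (con 1ℚ :- w) :* (con 1ℚ :- n :* w) := con 1ℚ :- (con 1ℚ :+ n) :* w :+ n :* (w :* w)) refl (fromℕℚ n) w) ⟩
  (1ℚ - w) * (1ℚ - fromℕℚ n * w)       ≤⟨ *-monoʳ-≤ (1ℚ - w) (0≤- w≤1) (1-*≤^ 0≤w w≤1 n) ⟩
  (1ℚ - w) ^ suc n                     ∎
  where open ≤-Reasoning

½^*2^ : ∀ n → ½ ^ n * fromℕℚ (2 ℕ.^ n) ≡ 1ℚ
½^*2^ zero    = refl
½^*2^ (suc n) = trans (cong (λ t → ½ ^ suc n * t) (fromℕℚ-* 2 (2 ℕ.^ n)))
  (trans (solve 2 (λ p t → con ½ :* p :* (con (fromℕℚ 2) :* t) := p :* t) refl (½ ^ n) (fromℕℚ (2 ℕ.^ n))) (½^*2^ n))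

-- By Bernoulli's inequality each block of M ≤ (k + 1)² / 2 factors is at least ½.
½^≤[1-unit²]^ : ∀ k M s {n} → 2 ℕ.* M ℕ.≤ suc k ℕ.* suc k → n ℕ.≤ M ℕ.* s → ½ ^ s ≤ (1ℚ - unit k * unit k) ^ n
½^≤[1-unit²]^ k M s {n} 2M≤k² n≤Ms = begin
  ½ ^ s             ≤⟨ ^-monoˡ-≤ (<⇒≤ (positive⁻¹ ½)) ½≤p^M s ⟩
  (p ^ M) ^ s       ≡⟨ ^-assocʳ p M s ⟩
  p ^ (M ℕ.* s)     ≤⟨ ^-antitone (proj₁ 0≤p≤1) (proj₂ 0≤p≤1) n≤Ms ⟩
  p ^ n             ∎
  where
  open ≤-Reasoning
  w p : ℚ
  w = unit k * unit k
  p = 1ℚ - w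
  0≤p≤1 = 0≤1-≤1 (0≤unit² k) (unit²≤1 k)

  2Mw≤1 : fromℕℚ 2 * (fromℕℚ M * w) ≤ 1ℚ
  2Mw≤1 = begin
    fromℕℚ 2 * (fromℕℚ M * w)          ≡⟨ *-assoc (fromℕℚ 2) (fromℕℚ M) w ⟨
    fromℕℚ 2 * fromℕℚ M * w            ≡⟨ cong (_* w) (fromℕℚ-* 2 M) ⟨
    fromℕℚ (2 ℕ.* M) * w               ≤⟨ *-monoˡ-≤ w (0≤unit² k) (fromℕℚ-mono 2M≤k²) ⟩
    fromℕℚ (suc k ℕ.* suc k) * w       ≡⟨ cong (_* w) (fromℕℚ-* (suc k) (suc k)) ⟩
    fromℕℚ (suc k) * fromℕℚ (suc k) * (unit k * unit k)
      ≡⟨ solve 2 (λ K u → K :* K :* (u :* u) := (K :* u) :* (K :* u)) refl (fromℕℚ (suc k)) (unit k) ⟩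
    (fromℕℚ (suc k) * unit k) * (fromℕℚ (suc k) * unit k)
      ≡⟨ cong₂ _*_ (suc*unit k) (suc*unit k) ⟩
    1ℚ ∎

  ½≤p^M : ½ ≤ p ^ M
  ½≤p^M = ≤-trans
    (≤-by ((1ℚ - fromℕℚ 2 * (fromℕℚ M * w)) * ½) (0≤* (0≤- 2Mw≤1) (<⇒≤ (positive⁻¹ ½)))
      (solve 1 (λ x → con 1ℚ :- x := con ½ :+ (con 1ℚ :- con (fromℕℚ 2) :* x) :* con ½) refl (fromℕℚ M * w)))
    (1-*≤^ (0≤unit² k) (unit²≤1 k) M)

¼ : ℚ
¼ = + 1 / 4

-- 1 - r ≤ (1 - r/4)⁴, so Bernoulli's inequality for (1 - r/4)ᵏ yields a polynomial
-- bound of degree 4 on (1 - r)ᵏ.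
[1-]^≤ : ∀ {q r} k → 0ℚ ≤ q → 0ℚ < r → r ≤ 1ℚ → q ≤ 1ℚ - r →
  ∃[ a ] 0ℚ ≤ a × q ^ k ≤ a ^ 4 × a * (fromℕℚ k * (r * ¼)) ≤ 1ℚ
[1-]^≤ {q} {r} k 0≤q 0<r r≤1 q≤1-r = b ^ k , 0≤a , q^k≤ , ≤-trans
  (≤-by (b ^ k) 0≤a (solve 3 (λ a k r → a :* (con 1ℚ :+ k :* (con 1ℚ :- (con 1ℚ :- r :* con ¼))) := a :* (k :* (r :* con ¼)) :+ a) refl (b ^ k) (fromℕℚ k) r))
  (bernoulli 0≤b b<1 k)
  where
  open ≤-Reasoning
  y b : ℚ
  y = r * ¼
  b = 1ℚ - y

  0<y : 0ℚ < y
  0<y = 0<* 0<r (positive⁻¹ ¼)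

  y≤1 : y ≤ 1ℚ
  y≤1 = *-mono₂ (<⇒≤ (positive⁻¹ ¼)) 0≤1 r≤1 (unit≤1 3)

  0≤b : 0ℚ ≤ b
  0≤b = 0≤- y≤1

  b<1 : b < 1ℚ
  b<1 = +-monoʳ-< 1ℚ (neg-antimono-< 0<y)

  0≤a : 0ℚ ≤ b ^ k
  0≤a = ^-nonNeg 0≤b k

  q≤b⁴ : q ≤ b ^ 4
  -- The remainder is (1 - y)⁴ - (1 - 4 y) = y² ((2 - y)² + 2), with 4 y = r and 2 - y = 1 + b.
  q≤b⁴ = ≤-trans q≤1-r (≤-by (y * y * ((1ℚ + b) * (1ℚ + b) + (1ℚ + 1ℚ))) (0≤* (0≤square y) (0≤+ (0≤square (1ℚ + b)) (0≤+ 0≤1 0≤1)))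
    (solve 1 (λ r → let y = r :* con ¼ ; b = con 1ℚ :- y in
      b :* (b :* (b :* (b :* con 1ℚ))) := (con 1ℚ :- r) :+ y :* y :* ((con 1ℚ :+ b) :* (con 1ℚ :+ b) :+ (con 1ℚ :+ con 1ℚ))) refl r))

  q^k≤ : q ^ k ≤ (b ^ k) ^ 4
  q^k≤ = begin
    q ^ k           ≤⟨ ^-monoˡ-≤ 0≤q q≤b⁴ k ⟩
    (b ^ 4) ^ k     ≡⟨ trans (^-assocʳ b 4 k) (cong (b ^_) (ℕₚ.*-comm 4 k)) ⟩
    b ^ (k ℕ.* 4)   ≡⟨ ^-assocʳ b k 4 ⟨
    (b ^ k) ^ 4     ∎

suc≤2^ : ∀ t → suc t ℕ.≤ 2 ℕ.^ t
suc≤2^ zero    = s≤s z≤n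
suc≤2^ (suc t) = begin
  suc (suc t)                     ≤⟨ s≤s (suc≤2^ t) ⟩
  1 ℕ.+ 2 ℕ.^ t                   ≤⟨ ℕₚ.+-monoˡ-≤ (2 ℕ.^ t) (ℕₚ.≤-trans (s≤s z≤n) (suc≤2^ t)) ⟩
  2 ℕ.^ t ℕ.+ 2 ℕ.^ t             ≡⟨ cong (2 ℕ.^ t ℕ.+_) (ℕₚ.+-identityʳ (2 ℕ.^ t)) ⟨
  2 ℕ.^ suc t                     ∎
  where open ℕₚ.≤-Reasoning

module _ {n a K s R : ℚ} (0≤n : 0ℚ ≤ n) (0≤a : 0ℚ ≤ a) (0≤K : 0ℚ ≤ K) (0<R : 0ℚ < R)
  (R⁸≤n : R ^ 8 ≤ n) (s≤R : s ≤ R) (8n≤K²s : fromℕℚ 8 * n ≤ K * K * s) where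

  -- a K ≤ 8 R and 8 n ≤ K² s give n a² ≤ 8 R³, and R⁸ ≤ n then gives R² n a⁴ ≤ 64.
  final-estimate : ∀ {r c} → r * (fromℕℚ 2 * R) ≡ 1ℚ → a * (K * (r * ¼)) ≤ 1ℚ →
    fromℕℚ 64 ≤ R * R * c → n * a ^ 4 ≤ c
  final-estimate {r} {c} r2R≡1 aKr/4≤1 64≤R²c = *-cancelˡ-≤ (R * R) (0<* 0<R 0<R) (≤-trans R²na⁴≤64 64≤R²c)
    where
    open ≤-Reasoning
    0≤R : 0ℚ ≤ R
    0≤R = <⇒≤ 0<R

    0≤aK : 0ℚ ≤ a * K
    0≤aK = 0≤* 0≤a 0≤K

    aK≤8R : a * K ≤ fromℕℚ 8 * R
    aK≤8R = begin
      a * K                                     ≡⟨ *-identityʳ (a * K) ⟨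
      a * K * 1ℚ                                ≡⟨ cong (a * K *_) r2R≡1 ⟨
      a * K * (r * (fromℕℚ 2 * R))              ≡⟨ solve 4 (λ a K r R → a :* K :* (r :* (con (fromℕℚ 2) :* R)) := (a :* (K :* (r :* con ¼))) :* (con (fromℕℚ 8) :* R)) refl a K r R ⟩
      a * (K * (r * ¼)) * (fromℕℚ 8 * R)        ≤⟨ *-monoˡ-≤ (fromℕℚ 8 * R) (0≤* (0≤fromℕℚ 8) 0≤R) aKr/4≤1 ⟩
      1ℚ * (fromℕℚ 8 * R)                       ≡⟨ *-identityˡ _ ⟩
      fromℕℚ 8 * R                              ∎

    na²≤8R³ : n * (a * a) ≤ fromℕℚ 8 * (R * R * R)
    na²≤8R³ = *-cancelˡ-≤ (fromℕℚ 8) (positive⁻¹ (fromℕℚ 8)) (begin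
      fromℕℚ 8 * (n * (a * a))                  ≡⟨ *-assoc (fromℕℚ 8) n (a * a) ⟨
      fromℕℚ 8 * n * (a * a)                    ≤⟨ *-monoˡ-≤ (a * a) (0≤square a) 8n≤K²s ⟩
      K * K * s * (a * a)                       ≤⟨ *-monoˡ-≤ (a * a) (0≤square a) (*-monoʳ-≤ (K * K) (0≤square K) s≤R) ⟩
      K * K * R * (a * a)                       ≡⟨ solve 3 (λ K R a → K :* K :* R :* (a :* a) := (a :* K) :* (a :* K) :* R) refl K R a ⟩
      (a * K) * (a * K) * R                     ≤⟨ *-monoˡ-≤ R 0≤R (*-mono₂ 0≤aK (0≤* (0≤fromℕℚ 8) 0≤R) aK≤8R aK≤8R) ⟩
      (fromℕℚ 8 * R) * (fromℕℚ 8 * R) * R       ≡⟨ solve 1 (λ R → (con (fromℕℚ 8) :* R) :* (con (fromℕℚ 8) :* R) :* R := con (fromℕℚ 8) :* (con (fromℕℚ 8) :* (R :* R :* R))) refl R ⟩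
      fromℕℚ 8 * (fromℕℚ 8 * (R * R * R))       ∎)

    0≤na² : 0ℚ ≤ n * (a * a)
    0≤na² = 0≤* 0≤n (0≤square a)

    R²na⁴≤64 : R * R * (n * a ^ 4) ≤ fromℕℚ 64
    -- Multiplication by R⁶ produces R⁸, which may be replaced by n; this completes the square (n
    -- a²)².
    R²na⁴≤64 = *-cancelˡ-≤ (R ^ 6) (0<R^ 6) (begin
      R ^ 6 * (R * R * (n * a ^ 4))
        ≡⟨ solve 3 (λ R n a → (R :* (R :* (R :* (R :* (R :* (R :* con 1ℚ)))))) :* (R :* R :* (n :* (a :* (a :* (a :* (a :* con 1ℚ)))))) :=
             (R :* (R :* (R :* (R :* (R :* (R :* (R :* (R :* con 1ℚ)))))))) :* (n :* (a :* a) :* (a :* a))) refl R n a ⟩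
      R ^ 8 * (n * (a * a) * (a * a))
        ≤⟨ *-monoˡ-≤ (n * (a * a) * (a * a)) (0≤* 0≤na² (0≤square a)) R⁸≤n ⟩
      n * (n * (a * a) * (a * a))
        ≡⟨ solve 2 (λ n a → n :* (n :* (a :* a) :* (a :* a)) := (n :* (a :* a)) :* (n :* (a :* a))) refl n a ⟩
      (n * (a * a)) * (n * (a * a))
        ≤⟨ *-mono₂ 0≤na² (≤-trans 0≤na² na²≤8R³) na²≤8R³ na²≤8R³ ⟩
      (fromℕℚ 8 * (R * R * R)) * (fromℕℚ 8 * (R * R * R))
        ≡⟨ solve 1 (λ R → (con (fromℕℚ 8) :* (R :* R :* R)) :* (con (fromℕℚ 8) :* (R :* R :* R)) :=
             (R :* (R :* (R :* (R :* (R :* (R :* con 1ℚ)))))) :* con (fromℕℚ 64)) refl R ⟩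
      R ^ 6 * fromℕℚ 64 ∎)
      where
      0<R^ : ∀ n → 0ℚ < R ^ n
      0<R^ zero    = 0<1
      0<R^ (suc n) = 0<* 0<R (0<R^ n)

fromℕℚ-^ : ∀ m n → fromℕℚ (m ℕ.^ n) ≡ fromℕℚ m ^ n
fromℕℚ-^ m zero    = refl
fromℕℚ-^ m (suc n) = trans (fromℕℚ-* m (m ℕ.^ n)) (cong (fromℕℚ m *_) (fromℕℚ-^ m n))

m≤1+[m/n]*n : ∀ m n .⦃ _ : NonZero n ⦄ → m ℕ.≤ suc (m ℕ./ n) ℕ.* n
m≤1+[m/n]*n m n = begin
  m                              ≡⟨ ℕ.m≡m%n+[m/n]*n m n ⟩
  m ℕ.% n ℕ.+ m ℕ./ n ℕ.* n      ≤⟨ ℕₚ.+-monoˡ-≤ _ (ℕₚ.<⇒≤ (ℕ.m%n<n m n)) ⟩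
  n ℕ.+ m ℕ./ n ℕ.* n            ∎
  where open ℕₚ.≤-Reasoning

-- By induction on n: t stays the same until n reaches the next e-th power of a power of 2, and then
-- it grows by one.
between-powers : ∀ e .⦃ _ : NonZero e ⦄ n .⦃ _ : NonZero n ⦄ →
  ∃[ t ] (2 ℕ.^ t) ℕ.^ e ℕ.≤ n × n ℕ.< (2 ℕ.^ suc t) ℕ.^ e
between-powers e (suc zero)    = 0 , ℕₚ.≤-reflexive (ℕₚ.^-zeroˡ e) , (begin-strict
  1           ≡⟨ ℕₚ.^-zeroˡ e ⟨
  1 ℕ.^ e     <⟨ ℕₚ.^-monoˡ-< e (s≤s (s≤s z≤n)) ⟩
  2 ℕ.^ e     ∎)
  where open ℕₚ.≤-Reasoning
between-powers e (suc n@(suc _)) with between-powers e n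
... | t , lower , upper with suc n ℕ.<? (2 ℕ.^ suc t) ℕ.^ e
...   | yes n+1<  = t , ℕₚ.m≤n⇒m≤1+n lower , n+1<
...   | no  n+1≮  = suc t , ℕₚ.≮⇒≥ n+1≮ , ℕₚ.≤-<-trans upper
  (ℕₚ.^-monoˡ-< e (ℕₚ.^-monoʳ-< 2 (s≤s (s≤s z≤n)) (ℕₚ.n<1+n (suc t))))

-- With R = 2^t and s = t + 1, grouping the n factors into s blocks gives 1 - q ≥ ½^s = 1 / (2R).
-- Then `[1-]^≤` and `final-estimate` apply, and t₀ is chosen with 64 ≤ t c for all t ≥ t₀, where t
-- ≤ R².
hitProbability^-small : ∀ {c} → 0ℚ < c → ∃[ t₀ ] ∀ t → t₀ ℕ.≤ t → ∀ n k →
  (2 ℕ.^ t) ℕ.^ 8 ℕ.≤ n → 8 ℕ.* n ℕ.≤ suc k ℕ.* suc k ℕ.* suc t →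
  fromℕℚ n * hitProbability k n ^ suc k ≤ c
hitProbability^-small {c} 0<c = let t₀ , large = archimedean (fromℕℚ 64) 0<c in
  t₀ , λ t t₀≤t n k R⁸≤n 8n≤k²s → small t n k R⁸≤n 8n≤k²s (large t t₀≤t)
  where
  small : ∀ t n k → (2 ℕ.^ t) ℕ.^ 8 ℕ.≤ n → 8 ℕ.* n ℕ.≤ suc k ℕ.* suc k ℕ.* suc t →
    fromℕℚ 64 ≤ fromℕℚ t * c → fromℕℚ n * hitProbability k n ^ suc k ≤ c
  small t n k R⁸≤n 8n≤k²s 64≤tc =
    let a , 0≤a , q^K≤a⁴ , aKr/4≤1 = [1-]^≤ {r = r} (suc k) (proj₁ (0≤hitProbability≤1 k n)) 0<r r≤1 q≤1-r in
    ≤-trans (*-monoʳ-≤ (fromℕℚ n) (0≤fromℕℚ n) q^K≤a⁴)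
      (final-estimate {K = fromℕℚ (suc k)} (0≤fromℕℚ n) 0≤a (0≤fromℕℚ (suc k)) 0<R R^8≤n s≤R 8n≤K²s {r} r2R≡1 aKr/4≤1 64≤R²c)
    where
    s : ℕ
    s = suc t
    R r : ℚ
    R = fromℕℚ (2 ℕ.^ t)
    r = ½ ^ s

    1≤2^t : 1 ℕ.≤ 2 ℕ.^ t
    1≤2^t = ℕₚ.≤-trans (s≤s z≤n) (suc≤2^ t)

    1≤R : 1ℚ ≤ R
    1≤R = fromℕℚ-mono 1≤2^t

    0<R : 0ℚ < R
    0<R = <-≤-trans 0<1 1≤R

    s≤R : fromℕℚ s ≤ R
    s≤R = fromℕℚ-mono (suc≤2^ t)

    R^8≤n : R ^ 8 ≤ fromℕℚ n
    R^8≤n = ≤-trans (≤-reflexive (sym (fromℕℚ-^ (2 ℕ.^ t) 8))) (fromℕℚ-mono R⁸≤n)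

    8n≤K²s : fromℕℚ 8 * fromℕℚ n ≤ fromℕℚ (suc k) * fromℕℚ (suc k) * fromℕℚ s
    8n≤K²s = subst₂ _≤_ (fromℕℚ-* 8 n)
      (trans (fromℕℚ-* (suc k ℕ.* suc k) s) (cong (_* fromℕℚ s) (fromℕℚ-* (suc k) (suc k))))
      (fromℕℚ-mono 8n≤k²s)

    64≤R²c : fromℕℚ 64 ≤ R * R * c
    64≤R²c = ≤-trans 64≤tc (*-monoˡ-≤ c (<⇒≤ 0<c) (begin
      fromℕℚ t    ≤⟨ fromℕℚ-mono (ℕₚ.n≤1+n t) ⟩
      fromℕℚ s    ≤⟨ s≤R ⟩
      R           ≡⟨ *-identityʳ R ⟨
      R * 1ℚ      ≤⟨ *-monoʳ-≤ R (<⇒≤ 0<R) 1≤R ⟩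
      R * R       ∎))
      where open ≤-Reasoning

    r2R≡1 : r * (fromℕℚ 2 * R) ≡ 1ℚ
    r2R≡1 = trans (cong (r *_) (sym (fromℕℚ-* 2 (2 ℕ.^ t)))) (½^*2^ s)

    0<½^ : ∀ n → 0ℚ < ½ ^ n
    0<½^ zero    = 0<1
    0<½^ (suc n) = 0<* (positive⁻¹ ½) (0<½^ n)

    0<r : 0ℚ < r
    0<r = 0<½^ s

    r≤1 : r ≤ 1ℚ
    r≤1 = proj₂ (0≤^≤1 (<⇒≤ (positive⁻¹ ½)) (unit≤1 1) s)

    s≤n : s ℕ.≤ n
    s≤n = begin
      s                    ≤⟨ suc≤2^ t ⟩
      2 ℕ.^ t              ≡⟨ ℕₚ.^-identityʳ (2 ℕ.^ t) ⟨
      (2 ℕ.^ t) ℕ.^ 1      ≤⟨ ℕₚ.^-monoʳ-≤ (2 ℕ.^ t) ⦃ ℕₚ.m^n≢0 2 t ⦄ {1} {8} (s≤s z≤n) ⟩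
      (2 ℕ.^ t) ℕ.^ 8      ≤⟨ R⁸≤n ⟩
      n                    ∎
      where open ℕₚ.≤-Reasoning

    M : ℕ
    -- Rounded up, so that s blocks of length M cover n factors. The rounding costs an extra 8 ≤ k²
    -- in `2M≤k²`, which comes from s ≤ n.
    M = suc (n ℕ./ s)

    2M≤k² : 2 ℕ.* M ℕ.≤ suc k ℕ.* suc k
    2M≤k² = ℕₚ.*-cancelˡ-≤ 4 (begin
      4 ℕ.* (2 ℕ.* M)                    ≡⟨ ℕₚ.*-assoc 4 2 M ⟨
      8 ℕ.* suc (n ℕ./ s)                ≡⟨ ℕₚ.*-suc 8 (n ℕ./ s) ⟩
      8 ℕ.+ 8 ℕ.* (n ℕ./ s)              ≤⟨ ℕₚ.+-mono-≤ 8≤k² 8[n/s]≤k² ⟩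
      k² ℕ.+ k²                          ≡⟨ cong (k² ℕ.+_) (ℕₚ.+-identityʳ k²) ⟨
      2 ℕ.* k²                           ≤⟨ ℕₚ.*-monoˡ-≤ k² {2} {4} (s≤s (s≤s z≤n)) ⟩
      4 ℕ.* k²                           ∎)
      where
      open ℕₚ.≤-Reasoning
      k² : ℕ
      k² = suc k ℕ.* suc k
      8≤k² : 8 ℕ.≤ k²
      8≤k² = ℕₚ.*-cancelʳ-≤ 8 k² s (ℕₚ.≤-trans (ℕₚ.*-monoʳ-≤ 8 s≤n) 8n≤k²s)
      8[n/s]≤k² : 8 ℕ.* (n ℕ./ s) ℕ.≤ k²
      8[n/s]≤k² = ℕₚ.*-cancelʳ-≤ (8 ℕ.* (n ℕ./ s)) k² s (begin
        8 ℕ.* (n ℕ./ s) ℕ.* s     ≡⟨ ℕₚ.*-assoc 8 (n ℕ./ s) s ⟩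
        8 ℕ.* (n ℕ./ s ℕ.* s)     ≤⟨ ℕₚ.*-monoʳ-≤ 8 (ℕ.m/n*n≤m n s) ⟩
        8 ℕ.* n                   ≤⟨ 8n≤k²s ⟩
        k² ℕ.* s                  ∎)

    q≤1-r : hitProbability k n ≤ 1ℚ - r
    q≤1-r = +-monoʳ-≤ 1ℚ (neg-antimono-≤ (½^≤[1-unit²]^ k M s 2M≤k² (m≤1+[m/n]*n n s)))

-- Consequences of the density hypothesis

-- The first term of the series is enough, because (q - 1) / (q + 1) ≥ ½ for q ≥ 3.
1≤log : ∀ {q} (1<q : 1ℚ < q) → fromℕℚ 3 ≤ q → ∀ n → 1 ℕ.≤ n → 1ℚ ≤ seq (log q (1<q⇒0<q 1<q)) n
1≤log {q} 1<q 3≤q n 1≤n = begin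
  1ℚ                          ≡⟨⟩
  2ℚ * ½                      ≤⟨ *-monoʳ-≤ 2ℚ (<⇒≤ (positive⁻¹ 2ℚ)) ½≤z ⟩
  2ℚ * z                      ≡⟨ cong (2ℚ *_) (solve 1 (λ z → z := con 0ℚ :+ z :* con 1ℚ :* con 1ℚ) refl z) ⟩
  2ℚ * artanhSum z 1          ≤⟨ *-monoʳ-≤ 2ℚ (<⇒≤ (positive⁻¹ 2ℚ)) (artanhSum-lower (≤-trans (<⇒≤ (positive⁻¹ ½)) ½≤z) n 1≤n) ⟩
  2ℚ * artanhSum z n          ∎
  where
  open ≤-Reasoning
  z : ℚ
  z = cayley q (1<q⇒0<q 1<q)
  ½≤z : ½ ≤ z
  ½≤z = *-cancelˡ-≤ (q + 1ℚ) (+-mono-< (1<q⇒0<q 1<q) 0<1) (begin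
    (q + 1ℚ) * ½              ≤⟨ ≤-by ((q - fromℕℚ 3) * ½) (0≤* (0≤- 3≤q) (<⇒≤ (positive⁻¹ ½)))
                                   (solve 1 (λ q → q :- con 1ℚ := (q :+ con 1ℚ) :* con ½ :+ (q :- con (fromℕℚ 3)) :* con ½) refl q) ⟩
    q - 1ℚ                    ≡⟨ trans (*-comm (q + 1ℚ) z) (cayley-* q (1<q⇒0<q 1<q)) ⟨
    (q + 1ℚ) * z              ∎)

length-cartesianProduct : ∀ {A B : Set} (xs : List A) (ys : List B) →
  length (cartesianProduct xs ys) ≡ length xs ℕ.* length ys
length-cartesianProduct []       ys = refl
length-cartesianProduct (x ∷ xs) ys = trans (Listₚ.length-++ (List.map (x ,_) ys))
  (cong₂ ℕ._+_ (Listₚ.length-map (x ,_) ys) (length-cartesianProduct xs ys))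

edgeCount≤n² : ∀ {n} (G : Graph n) → edgeCount G ℕ.≤ n ℕ.* n
edgeCount≤n² {n} G = begin
  edgeCount G
    ≤⟨ Listₚ.length-filter _ (cartesianProduct (List.allFin n) (List.allFin n)) ⟩
  length (cartesianProduct (List.allFin n) (List.allFin n))
    ≡⟨ length-cartesianProduct (List.allFin n) (List.allFin n) ⟩
  length (List.allFin n) ℕ.* length (List.allFin n)
    ≡⟨ cong (λ l → l ℕ.* l) (Listₚ.length-tabulate {n = n} (λ i → i)) ⟩
  n ℕ.* n ∎
  where open ℕₚ.≤-Reasoning

≤+ε⇒≤ : ∀ {a b} → (∀ ε → 0ℚ < ε → a ≤ b + ε) → a ≤ b
≤+ε⇒≤ {a} {b} h with a ≤? b
... | yes a≤b = a≤b
... | no  a≰b = ⊥-elim (<-irrefl refl (begin-strict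
  a                   ≤⟨ h ((a - b) * ½) (half 0<a-b) ⟩
  b + (a - b) * ½     <⟨ +-monoʳ-< b (subst₂ _<_ (+-identityʳ ((a - b) * ½)) (half+half (a - b)) (+-monoʳ-< ((a - b) * ½) (half 0<a-b))) ⟩
  b + (a - b)         ≡⟨ solve 2 (λ a b → b :+ (a :- b) := a) refl a b ⟩
  a                   ∎))
  where
  open ≤-Reasoning
  0<a-b : 0ℚ < a - b
  0<a-b = subst (_< a - b) (+-inverseʳ b) (+-monoˡ-< (ℚ.- b) (≰⇒> a≰b))

-- As log n ≥ 1, already f n ≤ f n (log n)².
≤-of-*log² : ∀ x n .⦃ _ : NonZero n ⦄ → 3 ℕ.≤ n → ∣ x *ℝ (logℕ n *ℝ logℕ n) -ℝ 0ℝ ∣ℝ <ℝ fromℚ ¼ →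
  ∃[ N ] ∀ i → N ℕ.≤ i → seq x i ≤ ¼
≤-of-*log² x n 3≤n (ε , 0<ε , N , close) = suc N , λ i N<i → bound (seq x i) (seq (logℕ n) i)
  (1≤log 1<n (fromℕℚ-mono 3≤n) i (ℕₚ.≤-trans (s≤s z≤n) N<i))
  (≤-trans (≤-by ε (<⇒≤ 0<ε) refl) (close i (ℕₚ.<⇒≤ N<i)))
  where
  open ≤-Reasoning
  1<n : 1ℚ < fromℕℚ n
  1<n = <-≤-trans (+-monoʳ-< 1ℚ 0<1) (fromℕℚ-mono (ℕₚ.≤-trans (s≤s (s≤s z≤n)) 3≤n))

  bound : ∀ x l → 1ℚ ≤ l → ℚ.∣ x * (l * l) - 0ℚ ∣ ≤ ¼ → x ≤ ¼
  bound x l 1≤l ∣xl²∣≤ with ≤-total 0ℚ x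
  ... | inj₂ x≤0 = ≤-trans x≤0 (<⇒≤ (positive⁻¹ ¼))
  ... | inj₁ 0≤x = begin
    x                           ≡⟨ *-identityʳ x ⟨
    x * 1ℚ                      ≤⟨ *-monoʳ-≤ x 0≤x (*-mono₂ 0≤1 (≤-trans 0≤1 1≤l) 1≤l 1≤l) ⟩
    x * (l * l)                 ≡⟨ +-identityʳ (x * (l * l)) ⟨
    x * (l * l) - 0ℚ            ≤⟨ p≤∣p∣ (x * (l * l) - 0ℚ) ⟩
    ℚ.∣ x * (l * l) - 0ℚ ∣      ≤⟨ ∣xl²∣≤ ⟩
    ¼                           ∎

-- Applied with a = n² / 2 and b the number of edges m, this turns the real hypothesis into the
-- rational inequality m ≥ n² / 4.
1-¼≤⇒½≤ : ∀ {x : ℝ} {N a b} → (∀ i → N ℕ.≤ i → seq x i ≤ ¼) → 0ℚ ≤ a → (1ℝ -ℝ x) *ℝ fromℚ a ≤ℝ fromℚ b → a * ½ ≤ b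
1-¼≤⇒½≤ {x} {N} {a} {b} x≤¼ 0≤a a≤b = ≤+ε⇒≤ λ ε 0<ε → let M , close = a≤b ε 0<ε ; n = N ℕ.+ M in begin
  a * ½                  ≤⟨ ≤-by (a * (½ - seq x n)) (0≤* 0≤a (0≤- (≤-trans (x≤¼ n (ℕₚ.m≤m+n N M)) (≤-by ¼ (<⇒≤ (positive⁻¹ ¼)) refl))))
                              (solve 2 (λ a x → (con 1ℚ :- x) :* a := a :* con ½ :+ a :* (con ½ :- x)) refl a (seq x n)) ⟩
  (1ℚ - seq x n) * a     ≤⟨ close n (ℕₚ.m≤n+m M N) ⟩
  b + ε                  ∎
  where open ≤-Reasoning

module _ {n : ℕ} .⦃ _ : NonZero n ⦄ where

  0<fromℕℚ : 0ℚ < fromℕℚ n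
  0<fromℕℚ = positive⁻¹ (fromℕℚ n) ⦃ normalize-pos n 1 ⦄

  n≤4ρ : ∀ m → + (n ℕ.* n) / 2 * ½ ≤ fromℕℚ m → fromℕℚ n ≤ fromℕℚ 4 * (+ m / n)
  n≤4ρ m n²/4≤m = *-cancelˡ-≤ (fromℕℚ n) 0<fromℕℚ (begin
    fromℕℚ n * fromℕℚ n                  ≡⟨ fromℕℚ-* n n ⟨
    fromℕℚ (n ℕ.* n)                     ≡⟨ /-*-cancel (n ℕ.* n) 2 ⟨
    X * fromℕℚ 2                         ≡⟨ solve 1 (λ X → X :* con (fromℕℚ 2) := con (fromℕℚ 4) :* (X :* con ½)) refl X ⟩
    fromℕℚ 4 * (X * ½)                   ≤⟨ *-monoʳ-≤ (fromℕℚ 4) (0≤fromℕℚ 4) n²/4≤m ⟩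
    fromℕℚ 4 * fromℕℚ m                  ≡⟨ cong (fromℕℚ 4 *_) (/-*-cancel m n) ⟨
    fromℕℚ 4 * (+ m / n * fromℕℚ n)      ≡⟨ solve 3 (λ a r n → a :* (r :* n) := n :* (a :* r)) refl (fromℕℚ 4) (+ m / n) (fromℕℚ n) ⟩
    fromℕℚ n * (fromℕℚ 4 * (+ m / n))    ∎)
    where
    open ≤-Reasoning
    X : ℚ
    X = + (n ℕ.* n) / 2

  ρ≤n : ∀ {m} → m ℕ.≤ n ℕ.* n → + m / n ≤ fromℕℚ n
  ρ≤n {m} m≤n² = *-cancelʳ-≤-pos (fromℕℚ n) ⦃ ℚ.positive 0<fromℕℚ ⦄ (begin
    + m / n * fromℕℚ n         ≡⟨ /-*-cancel m n ⟩
    fromℕℚ m                   ≤⟨ fromℕℚ-mono m≤n² ⟩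
    fromℕℚ (n ℕ.* n)           ≡⟨ fromℕℚ-* n n ⟩
    fromℕℚ n * fromℕℚ n        ∎)
    where open ≤-Reasoning

n≤4ρ⇒1<ρ : ∀ {n ρ} → 5 ℕ.≤ n → fromℕℚ n ≤ fromℕℚ 4 * ρ → 1ℚ < ρ
n≤4ρ⇒1<ρ {n} {ρ} 5≤n n≤ = *-cancelˡ-<-nonNeg (fromℕℚ 4) (<-≤-trans (p<p+1 (fromℕℚ 4)) (≤-trans (fromℕℚ-mono 5≤n) n≤))
  where
  p<p+1 : ∀ p → p * 1ℚ < p + 1ℚ
  p<p+1 p = subst (_< p + 1ℚ) (trans (+-identityʳ p) (sym (*-identityʳ p))) (+-monoʳ-< p 0<1)

-- 64 is 1 + δ, and 2 (2 + 8 (t + 1)) bounds log ρ for ρ ≤ (2 ^ (t + 1)) ^ 8.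
8n≤k²s : ∀ {n k t ρ} → fromℕℚ n ≤ fromℕℚ 4 * ρ →
  fromℕℚ 64 * fromℕℚ 64 * ρ ≤ (fromℕℚ 2 * fromℕℚ (suc k)) * (fromℕℚ 2 * fromℕℚ (suc k)) * (2ℚ * fromℕℚ (2 ℕ.+ suc t ℕ.* 8)) →
  8 ℕ.* n ℕ.≤ suc k ℕ.* suc k ℕ.* suc t
8n≤k²s {n} {k} {t} {ρ} n≤4ρ 64²ρ≤ = fromℕℚ-cancel-≤ (*-cancelˡ-≤ (fromℕℚ 128) (positive⁻¹ (fromℕℚ 128)) (begin
  fromℕℚ 128 * fromℕℚ (8 ℕ.* n)
    ≡⟨ cong (fromℕℚ 128 *_) (fromℕℚ-* 8 n) ⟩
  fromℕℚ 128 * (fromℕℚ 8 * fromℕℚ n)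
    ≤⟨ *-monoʳ-≤ (fromℕℚ 128) (0≤fromℕℚ 128) (*-monoʳ-≤ (fromℕℚ 8) (0≤fromℕℚ 8) n≤4ρ) ⟩
  fromℕℚ 128 * (fromℕℚ 8 * (fromℕℚ 4 * ρ))
    -- The origin of δ = 63: 128 · 8 · 4 = 64². The factor 4 relates n to ρ, 8 is the one in the
    -- conclusion, and 128 = 2² · 2 · 16 collects the rounding of the root, the 2 before artanh, and
    -- 2 + 8 s ≤ 16 s for s = t + 1.
    ≡⟨ solve 1 (λ ρ → con (fromℕℚ 128) :* (con (fromℕℚ 8) :* (con (fromℕℚ 4) :* ρ)) := con (fromℕℚ 64) :* con (fromℕℚ 64) :* ρ) refl ρ ⟩
  fromℕℚ 64 * fromℕℚ 64 * ρ
    ≤⟨ 64²ρ≤ ⟩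
  (fromℕℚ 2 * K) * (fromℕℚ 2 * K) * (2ℚ * fromℕℚ (2 ℕ.+ suc t ℕ.* 8))
    ≤⟨ *-monoʳ-≤ ((fromℕℚ 2 * K) * (fromℕℚ 2 * K)) (0≤square (fromℕℚ 2 * K)) (*-monoʳ-≤ 2ℚ (<⇒≤ (positive⁻¹ 2ℚ)) (begin
         fromℕℚ (2 ℕ.+ suc t ℕ.* 8)         ≤⟨ fromℕℚ-mono (ℕₚ.+-monoˡ-≤ (suc t ℕ.* 8) (ℕₚ.≤-trans (s≤s (s≤s z≤n)) (ℕₚ.m≤n*m 8 (suc t)))) ⟩
         fromℕℚ (suc t ℕ.* 8 ℕ.+ suc t ℕ.* 8) ≡⟨ cong fromℕℚ (ℕₚ.*-distribˡ-+ (suc t) 8 8) ⟨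
         fromℕℚ (suc t ℕ.* 16)               ≡⟨ fromℕℚ-* (suc t) 16 ⟩
         S * fromℕℚ 16                       ∎)) ⟩
  (fromℕℚ 2 * K) * (fromℕℚ 2 * K) * (2ℚ * (S * fromℕℚ 16))
    ≡⟨ solve 2 (λ K S → (con (fromℕℚ 2) :* K) :* (con (fromℕℚ 2) :* K) :* (con 2ℚ :* (S :* con (fromℕℚ 16))) := con (fromℕℚ 128) :* (K :* K :* S)) refl K S ⟩
  fromℕℚ 128 * (K * K * S)
    ≡⟨ cong (fromℕℚ 128 *_) (trans (fromℕℚ-* (suc k ℕ.* suc k) (suc t)) (cong (_* S) (fromℕℚ-* (suc k) (suc k)))) ⟨
  fromℕℚ 128 * fromℕℚ (suc k ℕ.* suc k ℕ.* suc t) ∎))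
  where
  open ≤-Reasoning
  K S : ℚ
  K = fromℕℚ (suc k)
  S = fromℕℚ (suc t)

theorem3p9 : (f : (n : ℕ) → .⦃ NonZero n ⦄ → ℝ) →
    (∀ n → .⦃ _ : NonZero n ⦄ → 0ℝ ≤ℝ f n) →
    (λ n → f n *ℝ (logℕ n *ℝ logℕ n)) ⟶ 0ℝ →
    (ε : ℝ) → 0ℝ <ℝ ε → ε <ℝ fromℚ ½ →
    ∃[ n₀ ] NonZero n₀ × ∃[ δ ] 0ℝ <ℝ δ ×
    (∀ n → .⦃ _ : NonZero n ⦄ → n₀ ℕ.≤ n → (G : Graph n) →
    (1ℝ -ℝ f n) *ℝ fromℚ (+ (n ℕ.* n) / 2) ≤ℝ fromℕ (edgeCount G) →
    (ρ : ℚ) → IsMaximumDensity G ρ → ρ ≡ + edgeCount G / n →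
    -- The inequality 1 < ρ makes log ρ positive and hence √ (ρ / log ρ) meaningful.
    Σ[ 1<ρ ∈ 1ℚ < ρ ]
    (∀ k → .⦃ _ : NonZero k ⦄ →
    (1ℝ +ℝ δ) *ℝ √ (divide (fromℚ ρ) (log ρ (1<q⇒0<q 1<ρ)) (log-pos 1<ρ)) ≤ℝ fromℕ k →
    1ℝ -ℝ ε ≤ℝ fromℚ (probabilityConflictColorable G k)))
theorem3p9 f _ f·log²→0 ε (c , 0<c , Nε , c≤ε) _ =
  n₀ , _ , fromℚ δ , (1ℚ , 0<1 , 0 , λ _ _ → fromℕℚ-mono {1} {63} (s≤s z≤n)) , main
  where
  δ : ℚ
  δ = fromℕℚ 63

  0<¼ : 0ℝ <ℝ fromℚ ¼
  0<¼ = ¼ , positive⁻¹ ¼ , 0 , λ _ _ → ≤-refl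

  t₀ Nf n₀ : ℕ
  t₀ = proj₁ (hitProbability^-small 0<c)
  Nf = proj₁ (f·log²→0 (fromℚ ¼) 0<¼)
  -- The summand 5 yields 1 < ρ and log n ≥ 1, `Nf` yields f n ≤ ¼, and the power forces t ≥ t₀.
  n₀ = 5 ℕ.+ (Nf ℕ.+ (2 ℕ.^ t₀) ℕ.^ 8)

  module _ (n : ℕ) .⦃ _ : NonZero n ⦄ (n₀≤n : n₀ ℕ.≤ n) (G : Graph n)
    (dense : (1ℝ -ℝ f n) *ℝ fromℚ (+ (n ℕ.* n) / 2) ≤ℝ fromℕ (edgeCount G)) where

    5≤n : 5 ℕ.≤ n
    5≤n = ℕₚ.m+n≤o⇒m≤o 5 n₀≤n

    n≤ : fromℕℚ n ≤ fromℕℚ 4 * (+ edgeCount G / n)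
    n≤ = n≤4ρ (edgeCount G) (1-¼≤⇒½≤ {f n} (proj₂ f≤¼) (nonNegative⁻¹ _ ⦃ normalize-nonNeg (n ℕ.* n) 2 ⦄) dense)
      where
      f≤¼ = ≤-of-*log² (f n) n (ℕₚ.≤-trans (s≤s (s≤s (s≤s z≤n))) 5≤n)
        (proj₂ (f·log²→0 (fromℚ ¼) 0<¼) n (ℕₚ.m+n≤o⇒m≤o Nf (ℕₚ.m+n≤o⇒n≤o 5 n₀≤n)))

    range : ∃[ t ] (2 ℕ.^ t) ℕ.^ 8 ℕ.≤ n × n ℕ.< (2 ℕ.^ suc t) ℕ.^ 8
    range = between-powers 8 n

    t : ℕ
    t = proj₁ range

    t₀≤t : t₀ ℕ.≤ t
    t₀≤t = ℕₚ.≮⇒≥ λ t<t₀ → ℕₚ.<⇒≱ (proj₂ (proj₂ range)) (begin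
      (2 ℕ.^ suc t) ℕ.^ 8     ≤⟨ ℕₚ.^-monoˡ-≤ 8 (ℕₚ.^-monoʳ-≤ 2 t<t₀) ⟩
      (2 ℕ.^ t₀) ℕ.^ 8        ≤⟨ ℕₚ.m+n≤o⇒n≤o Nf (ℕₚ.m+n≤o⇒n≤o 5 n₀≤n) ⟩
      n                       ∎)
      where open ℕₚ.≤-Reasoning

    ρ≤2^ : + edgeCount G / n ≤ fromℕℚ (2 ℕ.^ (suc t ℕ.* 8))
    ρ≤2^ = ≤-trans (ρ≤n (edgeCount≤n² G)) (fromℕℚ-mono
      (ℕₚ.≤-trans (ℕₚ.<⇒≤ (proj₂ (proj₂ range))) (ℕₚ.≤-reflexive (ℕₚ.^-*-assoc 2 (suc t) 8))))

    1<ρ : 1ℚ < + edgeCount G / n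
    1<ρ = n≤4ρ⇒1<ρ 5≤n n≤

    colorable : ∀ k → .⦃ _ : NonZero k ⦄ →
      (1ℝ +ℝ fromℚ δ) *ℝ √ (divide (fromℚ (+ edgeCount G / n)) (log (+ edgeCount G / n) (1<q⇒0<q 1<ρ)) (log-pos 1<ρ)) ≤ℝ fromℕ k →
      1ℝ -ℝ ε ≤ℝ fromℚ (probabilityConflictColorable G k)
    -- From index Nε on, ε is at least the rational c, so a failure probability of at most c
    -- suffices.
    colorable (suc k) √≤k η 0<η = Nε , λ i Nε≤i → begin
      1ℚ - seq ε i                                          ≤⟨ +-monoʳ-≤ 1ℚ (neg-antimono-≤ (subst (_≤ seq ε i) (+-identityˡ c) (c≤ε i Nε≤i))) ⟩
      1ℚ - c                                                ≤⟨ +-monoʳ-≤ 1ℚ (neg-antimono-≤ fail≤c) ⟩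
      1ℚ - fromℕℚ n * hitProbability k n ^ suc k            ≤⟨ probabilityConflictColorable-≥ G k ⟩
      probabilityConflictColorable G (suc k)                ≤⟨ ≤-by η (<⇒≤ 0<η) refl ⟩
      probabilityConflictColorable G (suc k) + η            ∎
      where
      open ≤-Reasoning
      fail≤c : fromℕℚ n * hitProbability k n ^ suc k ≤ c
      fail≤c = proj₂ (hitProbability^-small 0<c) t t₀≤t n k (proj₁ (proj₂ range))
        (8n≤k²s {n} {k} {t} {+ edgeCount G / n} n≤ (square-√divide-≤ {q = + edgeCount G / n} {log (+ edgeCount G / n) (1<q⇒0<q 1<ρ)} {δ = δ} {k = k} (log-pos 1<ρ) (<⇒≤ (1<q⇒0<q 1<ρ)) (0≤fromℕℚ 63)
          (0≤* (<⇒≤ (positive⁻¹ 2ℚ)) (0≤fromℕℚ (2 ℕ.+ suc t ℕ.* 8))) (log-≤ 1<ρ (suc t ℕ.* 8) ρ≤2^) √≤k))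

  main : ∀ n → .⦃ _ : NonZero n ⦄ → n₀ ℕ.≤ n → (G : Graph n) →
    (1ℝ -ℝ f n) *ℝ fromℚ (+ (n ℕ.* n) / 2) ≤ℝ fromℕ (edgeCount G) →
    (ρ : ℚ) → IsMaximumDensity G ρ → ρ ≡ + edgeCount G / n →
    Σ[ 1<ρ ∈ 1ℚ < ρ ]
    (∀ k → .⦃ _ : NonZero k ⦄ →
    (1ℝ +ℝ fromℚ δ) *ℝ √ (divide (fromℚ ρ) (log ρ (1<q⇒0<q 1<ρ)) (log-pos 1<ρ)) ≤ℝ fromℕ k →
    1ℝ -ℝ ε ≤ℝ fromℚ (probabilityConflictColorable G k))
  main n n₀≤n G dense ρ _ refl = 1<ρ n n₀≤n G dense , colorable n n₀≤n G dense
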